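{- $\mathbf{NP}_{\mathrm{IS}}=\mathrm{NP/poly}$, where each Boolean function family $(f_n)_{n\in\mathbb N}$ is identified with the unique function $f:\mathbb B^*\to\mathbb B$ such that $f(w)=f_n(w)$ for each $n$ and $w\in\mathbb B^n$.
   Context: Let $\mathbb B=\{\mathsf T,\mathsf F\}$. There are Boolean registers named $\mathtt{in}{:}i$, $\mathtt{aux}{:}i$ ($i\ge1$) and $\mathtt{out}$, processing methods $\mathtt{set{:}T}$ (content becomes $\mathsf T$, reply $\mathsf T$), $\mathtt{set{:}F}$ (content becomes $\mathsf F$, reply $\mathsf F$), $\mathtt{get}$ (no change, reply is the content). Basic instructions are $f.m$. Primitive instructions: for each basic instruction $a$, the plain instruction $a$, positive test $+a$, negative test $-a$; forward jumps $\#l$ ($l\in\mathbb N$); termination $!$. An instruction sequence is a finite non-empty sequence $X=u_1;\dots;u_k$ of primitive instructions, $|X|=k$. Execution starts at $u_1$: $a$ executes $a$ and proceeds with the next instruction; $+a$ executes $a$ and proceeds with the next instruction if the reply is $\mathsf T$, otherwise skips the next instruction and proceeds with the one after; $-a$ likewise with reply roles reversed; $\#l$ proceeds with the $l$-th next instruction ($\#0$ causes inaction); $!$ terminates; if there is no instruction to proceed with, inaction occurs. $\mathcal{IS}_{br}$ is the set of instruction sequences whose basic instructions are all of the forms $\mathtt{in}{:}i.\mathtt{get}$, $\mathtt{aux}{:}i.\mathtt{get}$, $\mathtt{aux}{:}i.\mathtt{set{:}}b$, $\mathtt{out}.\mathtt{set{:}}b$. $X$ computes $f:\mathbb B^n\to\mathbb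 B$ if for all $b_1,\dots,b_n$, executing $X$ with $\mathtt{in}{:}i$ initially $b_i$ ($i\le n$) and all auxiliary registers and $\mathtt{out}$ initially $\mathsf F$, execution never executes an instruction on $\mathtt{in}{:}i$ with $i>n$, ends by executing $!$, and leaves $f(b_1,\dots,b_n)$ in $\mathtt{out}$. A Boolean function family is a sequence $(f_n)_{n\in\mathbb N}$ with $f_n:\mathbb B^n\to\mathbb B$. $\mathbf P_{\mathrm{IS}}$ is the class of families $(g_n)$ for which there is a polynomial $h$ such that for every $n$ some $X\in\mathcal{IS}_{br}$ computes $g_n$ with $|X|\le h(n)$. $\mathbf{NP}_{\mathrm{IS}}$ is the class of families $(f_n)$ for which there exist a monotonic polynomial $h:\mathbb N\to\mathbb N$ and $(g_n)\in\mathbf P_{\mathrm{IS}}$ such that for all $n$ and $w\in\mathbb B^n$: $f_n(w)=\mathsf T\iff\exists c\in\mathbb B^{h(n)}\,g_{n+h(n)}(wc)=\mathsf T$ ($wc$ is concatenation). $\mathrm{NP/poly}$ is the standard non-uniform complexity class (NP with polynomial-length advice). -}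

module Defs where

open import Data.Bool using (Bool; true; false; if_then_else_)
open import Data.Nat using (ℕ; zero; suc; _+_; _≤_; _<?_; _≡ᵇ_)
open import Data.Fin using (Fin; toℕ; fromℕ<) renaming (zero to fz; suc to fs)
open import Data.List using (List; []; _∷_; length; _++_; lookup; map; concatMap)
open import Data.Vec using (Vec; fromList) renaming (_++_ to _++ᵥ_)
import Data.Vec as V
open import Data.Integer using (+_)
open import Data.Rational using (ℚ; _/_; 0ℚ) renaming (_+_ to _+ℚ_; _*_ to _*ℚ_)
open import Data.Product using (Σ; ∃; _×_; _,_)
open import Data.Maybe using (Maybe; just; nothing)
open import Relation.Binary.PropositionalEquality using (_≡_)
open import Relation.Nullary using (yes; no)
open import Data.List.Membership.Propositional using (_∈_)
open import Function.Bundles using (_⇔_)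

ℕtoℚ : ℕ → ℚ
ℕtoℚ n = + n / 1

evalPoly : List ℚ → ℚ → ℚ
evalPoly [] x = 0ℚ
evalPoly (a ∷ as) x = a +ℚ (x *ℚ evalPoly as x)

IsPolynomial : (ℕ → ℕ) → Set
IsPolynomial h = ∃ λ (cs : List ℚ) → ∀ n → ℕtoℚ (h n) ≡ evalPoly cs (ℕtoℚ n)

Monotonic : (ℕ → ℕ) → Set
Monotonic h = ∀ {m n} → m ≤ n → h m ≤ h n

BFamily : Set
BFamily = (n : ℕ) → Vec Bool n → Bool

toLang : BFamily → (List Bool → Bool)
toLang f w = f (length w) (fromList w)

-- Instruction sequences in IS_br
-- Register convention: inGet k is  in:(k+1).get ,  aux k is aux:(k+1).

data Basic : Set where
  inGet  : ℕ → Basic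
  auxGet : ℕ → Basic
  auxSet : ℕ → Bool → Basic
  outSet : Bool → Basic

data Prim : Set where
  plain : Basic → Prim
  ptest : Basic → Prim
  ntest : Basic → Prim
  jump  : ℕ → Prim
  halt  : Prim

InstrSeq : Set
InstrSeq = List Prim

NonEmpty : InstrSeq → Set
NonEmpty X = 1 ≤ length X

record ISState : Set where
  constructor st
  field
    pc  : ℕ            -- 0-based position of the current instruction
    aux : ℕ → Bool
    out : Bool

data Outcome : Set where
  terminated : Bool → Outcome
  inaction   : Outcome
  badInput   : Outcome
  outOfFuel  : Outcome

data StepResult : Set where
  continue : ISState → StepResult
  finished : Outcome → StepResult

doBasic : ∀ {n} → Vec Bool n → Basic → (ℕ → Bool) → Bool →
          Maybe ((ℕ → Bool) × Bool × Bool)   -- new aux, new out, reply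
doBasic {n} w (inGet k) a o with k <? n
... | yes k<n = just (a , o , V.lookup w (fromℕ< k<n))
... | no  _   = nothing
doBasic w (auxGet k) a o = just (a , o , a k)
doBasic w (auxSet k b) a o =
  just ((λ j → if j ≡ᵇ k then b else a j) , o , b)
doBasic w (outSet b) a o = just (a , b , b)

stepAt : ∀ {n} → Vec Bool n → Maybe Prim → ISState → StepResult
stepAt w nothing s = finished inaction
stepAt w (just (plain b)) (st p a o) with doBasic w b a o
... | nothing = finished badInput
... | just (a' , o' , r) = continue (st (suc p) a' o')
stepAt w (just (ptest b)) (st p a o) with doBasic w b a o
... | nothing = finished badInput
... | just (a' , o' , true)  = continue (st (suc p) a' o')
... | just (a' , o' , false) = continue (st (suc (suc p)) a' o')
stepAt w (just (ntest b)) (st p a o) with doBasic w b a o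
... | nothing = finished badInput
... | just (a' , o' , false) = continue (st (suc p) a' o')
... | just (a' , o' , true)  = continue (st (suc (suc p)) a' o')
stepAt w (just (jump zero)) s = finished inaction
stepAt w (just (jump (suc l))) (st p a o) = continue (st (p + suc l) a o)
stepAt w (just halt) (st p a o) = finished (terminated o)

fetch : InstrSeq → ℕ → Maybe Prim
fetch [] _ = nothing
fetch (u ∷ X) zero = just u
fetch (u ∷ X) (suc p) = fetch X p

run : ∀ {n} → InstrSeq → Vec Bool n → ℕ → ISState → Outcome
run X w zero s = outOfFuel
run X w (suc fuel) s with stepAt w (fetch X (ISState.pc s)) s
... | finished o = o
... | continue s' = run X w fuel s'

initState : ISState
initState = st 0 (λ _ → false) false

Computes : (n : ℕ) → InstrSeq → (Vec Bool n → Bool) → Set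
Computes n X f = ∀ (w : Vec Bool n) →
  ∃ λ fuel → run X w fuel initState ≡ terminated (f w)

P-IS : BFamily → Set
P-IS g = ∃ λ h → IsPolynomial h ×
  (∀ n → ∃ λ X → NonEmpty X × length X ≤ h n × Computes n X (g n))

NP-IS : BFamily → Set
NP-IS f = ∃ λ (h : ℕ → ℕ) → IsPolynomial h × Monotonic h ×
  ∃ λ (g : BFamily) → P-IS g ×
    (∀ n (w : Vec Bool n) →
       (f n w ≡ true) ⇔ (∃ λ (c : Vec Bool (h n)) → g (n + h n) (w ++ᵥ c) ≡ true))

-- Nondeterministic Turing machines (single two-way infinite tape)
-- Tape symbols: Fin (3 + k); symbol 0 = blank, 1 = bit F, 2 = bit T,
-- others are work symbols.  Start state 0.

data Move : Set where
  left right stay : Move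

record NTM : Set where
  field
    nstates  : ℕ
    nextra   : ℕ
    accept   : Fin (suc nstates)
    δ        : Fin (suc nstates) → Fin (3 + nextra) →
               List (Fin (suc nstates) × Fin (3 + nextra) × Move)

module _ (M : NTM) where
  open NTM M
  State = Fin (suc nstates)
  Sym   = Fin (3 + nextra)

  blank : Sym
  blank = fz

  bitSym : Bool → Sym
  bitSym false = fs fz
  bitSym true  = fs (fs fz)

  -- configuration: state, cells left of head (nearest first), head cell,
  -- cells right of head; omitted cells are blank
  record Config : Set where
    constructor cfg
    field
      state : State
      lft   : List Sym
      hd    : Sym
      rgt   : List Sym

  moveHead : Move → List Sym → Sym → List Sym → Config → Config
  moveHead stay l s r c = c
  moveHead left  [] s r (cfg q _ _ _) = cfg q [] blank (s ∷ r)
  moveHead left  (x ∷ l) s r (cfg q _ _ _) = cfg q l x (s ∷ r)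
  moveHead right l s [] (cfg q _ _ _) = cfg q (s ∷ l) blank []
  moveHead right l s (x ∷ r) (cfg q _ _ _) = cfg q (s ∷ l) x r

  apply : Config → State × Sym × Move → Config
  apply (cfg q l s r) (q' , s' , m) = moveHead m l s' r (cfg q' l s' r)

  data Step : Config → Config → Set where
    step : ∀ c t → t ∈ δ (Config.state c) (Config.hd c) → Step c (apply c t)

  data ReachWithin : ℕ → Config → Config → Set where
    here  : ∀ {t c} → ReachWithin t c c
    there : ∀ {t c c' c''} → Step c c' → ReachWithin t c' c'' →
            ReachWithin (suc t) c c''

  initConfig : List Bool → Config
  initConfig [] = cfg fz [] blank []
  initConfig (b ∷ bs) = cfg fz [] (bitSym b) (map bitSym bs)

  AcceptsWithin : List Bool → ℕ → Set
  AcceptsWithin x t = ∃ λ c → ReachWithin t (initConfig x) c × Config.state c ≡ accept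

NP : (List Bool → Bool) → Set
NP L = Σ NTM λ M → ∃ λ p → IsPolynomial p ×
  (∀ x → (L x ≡ true) ⇔ AcceptsWithin M x (p (length x)))

pair : List Bool → List Bool → List Bool
pair x y = concatMap (λ b → b ∷ b ∷ []) x ++ (false ∷ true ∷ []) ++ y

NP/poly : (List Bool → Bool) → Set
NP/poly L = ∃ λ (L' : List Bool → Bool) → NP L' ×
  ∃ λ (adv : ℕ → List Bool) → ∃ λ q → IsPolynomial q ×
    (∀ n → length (adv n) ≤ q n) ×
    (∀ x → L x ≡ L' (pair x (adv (length x))))

{-# OPTIONS --safe #-}
module Submission where

open import Defs
open import Algebra.Bundles using (CommutativeSemigroup)
import Algebra.Properties.CommutativeSemigroup as CommutativeSemigroupProperties
open import Data.Bool using (Bool; true; false; _∨_; _∧_; not; if_then_else_; T)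
import Data.Bool.Properties as Boolₚ
open import Data.Empty using (⊥; ⊥-elim)
open import Data.Fin using (Fin; toℕ; fromℕ<; combine; remQuot; _↑ʳ_) renaming (zero to fz; suc to fs)
import Data.Fin.Properties as Finₚ
open import Data.Integer using (-[1+_]; ∣_∣) renaming (+_ to pos)
import Data.Integer as ℤ
import Data.Integer.Properties as ℤₚ
open import Data.List using (List; []; _∷_; map; length; _++_; _ʳ++_; concatMap; drop; allFin)
import Data.List.Properties as Listₚ
open import Data.List.Membership.Propositional using (_∈_; find; lose)
open import Data.List.Membership.Propositional.Properties using (∈-allFin)
open import Data.List.Relation.Unary.Any using (here; there; any?)
open import Data.Maybe using (Maybe; just; nothing)
open import Data.Nat using (ℕ; zero; suc; pred; _+_; _*_; _∸_; _≤_; _<_; z≤n; s≤s; _≡ᵇ_; _<ᵇ_; _≤?_; _<?_; _≟_)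
import Data.Nat.Properties as ℕₚ
open import Data.Nat.Solver using (module +-*-Solver)
open import Data.Product using (Σ; ∃; _×_; _,_; proj₁; proj₂)
open import Data.Rational using (ℚ; mkℚ; 0ℚ; 1ℚ; ↥_) renaming (_+_ to _+ℚ_; _*_ to _*ℚ_; _≤_ to _≤ℚ_)
import Data.Rational as ℚ
import Data.Rational.Properties as ℚₚ
import Data.Rational.Unnormalised as ℚᵘ
import Data.Rational.Unnormalised.Properties as ℚᵘₚ
open import Data.Sum using (_⊎_; inj₁; inj₂)
open import Data.Unit using (⊤; tt)
open import Data.Vec using (Vec; []; _∷_; lookup; tabulate; toList; fromList) renaming (_++_ to _++ᵥ_)
import Data.Vec.Properties as Vecₚ
open import Function using (_∘_; id)
open import Function.Bundles using (_⇔_; mk⇔; module Equivalence)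
open import Relation.Binary using (tri<; tri≈; tri>)
open import Relation.Binary.PropositionalEquality using (_≡_; _≢_; refl; sym; trans; cong; cong₂; subst; subst₂; module ≡-Reasoning)
open import Relation.Nullary using (Dec; yes; no; ¬_; does)

open Equivalence using (to; from)

-- ⇒ : The state of a forward-jumping instruction sequence after each of its instructions is
-- a function of the inputs, so the sequence unrolls to a circuit with a constant number of
-- gates per instruction.  The advice is a matrix with one row per wire and one column per gate;
-- a fixed nondeterministic machine guesses a bit for every row and then checks one column per
-- left-to-right sweep.  Doubling in pair makes w itself the truncated top row of that matrix,
-- so the machine needs no special treatment of its input.
--
-- ⇐ : For input length n the machine, the time bound and the advice are fixed.  An instruction
-- sequence keeps the tape in auxiliary registers and the remaining time, the state and the head
-- position in its program counter; the certificate lists the nondeterministic choices.  Since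
-- the remaining time decreases, forward jumps suffice.

-- Polynomials

-- In ⇒ the machine is fixed while the circuits vary with n, so a circuit has to reach it as data.
-- The matrix spares the machine all arithmetic on wire numbers: a wire is a row, a gate is a
-- column, and consuming one cell per row in each sweep keeps the columns aligned without counters.
-- Certificate bits and gate outputs are guessed alike, so neither n nor the certificate length has
-- to be communicated. The alphabet is tight: of the four two-bit codes `pair` fixes 00, 11 and 01,
-- which leaves one more kind of cell, and two active kinds are enough for disjunction, negation and
-- comparison. In ⇐ the danger is size. The runs of the machine form a tree, so code is shared by
-- all branches that agree in remaining time, state and head position. The given polynomials have
-- rational coefficients and may fail to be monotonic; both directions replace them by upper bounds
-- with natural coefficients, which are monotonic and can be composed.

data Poly : Set where
  con   : ℕ → Poly
  var   : Poly
  _⊕_ _⊗_ : Poly → Poly → Poly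

infixl 6 _⊕_
infixl 7 _⊗_

⟦_⟧ : Poly → ℕ → ℕ
⟦ con c ⟧ n = c
⟦ var ⟧ n = n
⟦ a ⊕ b ⟧ n = ⟦ a ⟧ n + ⟦ b ⟧ n
⟦ a ⊗ b ⟧ n = ⟦ a ⟧ n * ⟦ b ⟧ n

⟦⟧-mono : ∀ e {m n} → m ≤ n → ⟦ e ⟧ m ≤ ⟦ e ⟧ n
⟦⟧-mono (con c) p = ℕₚ.≤-refl
⟦⟧-mono var p = p
⟦⟧-mono (a ⊕ b) p = ℕₚ.+-mono-≤ (⟦⟧-mono a p) (⟦⟧-mono b p)
⟦⟧-mono (a ⊗ b) p = ℕₚ.*-mono-≤ (⟦⟧-mono a p) (⟦⟧-mono b p)

_⟪_⟫ : Poly → Poly → Poly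
con c ⟪ e ⟫ = con c
var ⟪ e ⟫ = e
(a ⊕ b) ⟪ e ⟫ = a ⟪ e ⟫ ⊕ b ⟪ e ⟫
(a ⊗ b) ⟪ e ⟫ = a ⟪ e ⟫ ⊗ b ⟪ e ⟫

⟪⟫-eval : ∀ a e n → ⟦ a ⟪ e ⟫ ⟧ n ≡ ⟦ a ⟧ (⟦ e ⟧ n)
⟪⟫-eval (con c) e n = refl
⟪⟫-eval var e n = refl
⟪⟫-eval (a ⊕ b) e n = cong₂ _+_ (⟪⟫-eval a e n) (⟪⟫-eval b e n)
⟪⟫-eval (a ⊗ b) e n = cong₂ _*_ (⟪⟫-eval a e n) (⟪⟫-eval b e n)

toℚᵘ-ℕtoℚ : ∀ n → ℚ.toℚᵘ (ℕtoℚ n) ℚᵘ.≃ ℚᵘ.mkℚᵘ (pos n) 0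
toℚᵘ-ℕtoℚ n = ℚₚ.toℚᵘ-fromℚᵘ (ℚᵘ.mkℚᵘ (pos n) 0)

ℕtoℚ-+ : ∀ m n → ℕtoℚ (m + n) ≡ ℕtoℚ m +ℚ ℕtoℚ n
ℕtoℚ-+ m n = ℚₚ.toℚᵘ-injective (begin-equality
  ℚ.toℚᵘ (ℕtoℚ (m + n)) ≃⟨ toℚᵘ-ℕtoℚ (m + n) ⟩
  ℚᵘ.mkℚᵘ (pos (m + n)) 0 ≃⟨ ℚᵘ.*≡* (cong₂ ℤ._*_ (trans (ℤₚ.pos-+ m n) (sym (cong₂ ℤ._+_ (ℤₚ.*-identityʳ (pos m)) (ℤₚ.*-identityʳ (pos n))))) refl) ⟩
  ℚᵘ.mkℚᵘ (pos m) 0 ℚᵘ.+ ℚᵘ.mkℚᵘ (pos n) 0 ≃⟨ ℚᵘₚ.+-cong (toℚᵘ-ℕtoℚ m) (toℚᵘ-ℕtoℚ n) ⟨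
  ℚ.toℚᵘ (ℕtoℚ m) ℚᵘ.+ ℚ.toℚᵘ (ℕtoℚ n) ≃⟨ ℚₚ.toℚᵘ-homo-+ (ℕtoℚ m) (ℕtoℚ n) ⟨
  ℚ.toℚᵘ (ℕtoℚ m +ℚ ℕtoℚ n) ∎)
  where open ℚᵘₚ.≤-Reasoning

ℕtoℚ-* : ∀ m n → ℕtoℚ (m * n) ≡ ℕtoℚ m *ℚ ℕtoℚ n
ℕtoℚ-* m n = ℚₚ.toℚᵘ-injective (begin-equality
  ℚ.toℚᵘ (ℕtoℚ (m * n)) ≃⟨ toℚᵘ-ℕtoℚ (m * n) ⟩
  ℚᵘ.mkℚᵘ (pos (m * n)) 0 ≃⟨ ℚᵘ.*≡* (cong₂ ℤ._*_ (ℤₚ.pos-* m n) refl) ⟩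
  ℚᵘ.mkℚᵘ (pos m) 0 ℚᵘ.* ℚᵘ.mkℚᵘ (pos n) 0 ≃⟨ ℚᵘₚ.*-cong (toℚᵘ-ℕtoℚ m) (toℚᵘ-ℕtoℚ n) ⟨
  ℚ.toℚᵘ (ℕtoℚ m) ℚᵘ.* ℚ.toℚᵘ (ℕtoℚ n) ≃⟨ ℚₚ.toℚᵘ-homo-* (ℕtoℚ m) (ℕtoℚ n) ⟨
  ℚ.toℚᵘ (ℕtoℚ m *ℚ ℕtoℚ n) ∎)
  where open ℚᵘₚ.≤-Reasoning

ℕtoℚ-cancel-≤ : ∀ {m n} → ℕtoℚ m ≤ℚ ℕtoℚ n → m ≤ n
ℕtoℚ-cancel-≤ {m} {n} p = ℤ.drop‿+≤+ (subst₂ ℤ._≤_ (ℤₚ.*-identityʳ (pos m)) (ℤₚ.*-identityʳ (pos n)) (ℚᵘₚ.drop-*≤* q))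
  where
  q : ℚᵘ.mkℚᵘ (pos m) 0 ℚᵘ.≤ ℚᵘ.mkℚᵘ (pos n) 0
  q = ℚᵘₚ.≤-respˡ-≃ (toℚᵘ-ℕtoℚ m) (ℚᵘₚ.≤-respʳ-≃ (toℚᵘ-ℕtoℚ n) (ℚₚ.toℚᵘ-mono-≤ p))

-- The denominator is at least 1, so dropping it cannot decrease a nonnegative fraction; a negative
-- one lies below every natural number.
≤ℕtoℚ∣↥∣ : ∀ a → a ≤ℚ ℕtoℚ ∣ ↥ a ∣
≤ℕtoℚ∣↥∣ a@(mkℚ z d c) = ℚₚ.toℚᵘ-cancel-≤ (ℚᵘₚ.≤-respʳ-≃ (ℚᵘₚ.≃-sym (toℚᵘ-ℕtoℚ ∣ z ∣)) (ℚᵘ.*≤* (le z)))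
  where
  le : ∀ z → z ℤ.* ℤ.1ℤ ℤ.≤ pos ∣ z ∣ ℤ.* pos (suc d)
  le (pos n) = subst₂ ℤ._≤_ (sym (ℤₚ.*-identityʳ (pos n))) (ℤₚ.pos-* n (suc d)) (ℤ.+≤+ (ℕₚ.m≤m*n n (suc d)))
  le -[1+ n ] = ℤ.-≤+

0≤ℕtoℚ : ∀ n → 0ℚ ≤ℚ ℕtoℚ n
0≤ℕtoℚ n = ℚₚ.toℚᵘ-cancel-≤ (ℚᵘₚ.≤-respʳ-≃ (ℚᵘₚ.≃-sym (toℚᵘ-ℕtoℚ n)) (ℚᵘ.*≤* (subst (ℤ._≤_ _) (sym (ℤₚ.*-identityʳ (pos n))) (ℤ.+≤+ z≤n))))

hornerPoly : List ℚ → Poly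
hornerPoly [] = con 0
hornerPoly (a ∷ as) = con ∣ ↥ a ∣ ⊕ var ⊗ hornerPoly as

evalPoly≤hornerPoly : ∀ cs n → evalPoly cs (ℕtoℚ n) ≤ℚ ℕtoℚ (⟦ hornerPoly cs ⟧ n)
evalPoly≤hornerPoly [] n = 0≤ℕtoℚ 0
evalPoly≤hornerPoly (a ∷ as) n = subst (a +ℚ (x *ℚ evalPoly as x) ≤ℚ_) (sym eq)
  (ℚₚ.+-mono-≤ (≤ℕtoℚ∣↥∣ a) (ℚₚ.*-monoˡ-≤-nonNeg x {{ℚ.nonNegative (0≤ℕtoℚ n)}} (evalPoly≤hornerPoly as n)))
  where
  x : ℚ
  x = ℕtoℚ n
  m : ℕ
  m = ⟦ hornerPoly as ⟧ n
  eq : ℕtoℚ (∣ ↥ a ∣ + n * m) ≡ ℕtoℚ ∣ ↥ a ∣ +ℚ (x *ℚ ℕtoℚ m)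
  eq = trans (ℕtoℚ-+ ∣ ↥ a ∣ (n * m)) (cong (ℕtoℚ ∣ ↥ a ∣ +ℚ_) (ℕtoℚ-* n m))

-- Negative coefficients can make h decrease somewhere. Taking absolute numerators as coefficients
-- only increases the value at natural arguments and yields a monotonic bound.
dominated : ∀ {h} → IsPolynomial h → ∃ λ e → ∀ n → h n ≤ ⟦ e ⟧ n
dominated (cs , eq) = hornerPoly cs , λ n → ℕtoℚ-cancel-≤ (subst (_≤ℚ _) (sym (eq n)) (evalPoly≤hornerPoly cs n))

_+ₚ_ : List ℚ → List ℚ → List ℚ
[] +ₚ bs = bs
(a ∷ as) +ₚ [] = a ∷ as
(a ∷ as) +ₚ (b ∷ bs) = (a +ℚ b) ∷ (as +ₚ bs)

_*ₚ_ : List ℚ → List ℚ → List ℚ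
[] *ₚ bs = []
(a ∷ as) *ₚ bs = map (a *ℚ_) bs +ₚ (0ℚ ∷ (as *ₚ bs))

+ₚ-eval : ∀ as bs x → evalPoly (as +ₚ bs) x ≡ evalPoly as x +ℚ evalPoly bs x
+ₚ-eval [] bs x = sym (ℚₚ.+-identityˡ _)
+ₚ-eval (a ∷ as) [] x = sym (ℚₚ.+-identityʳ _)
+ₚ-eval (a ∷ as) (b ∷ bs) x = begin
  (a +ℚ b) +ℚ (x *ℚ evalPoly (as +ₚ bs) x) ≡⟨ cong (λ z → (a +ℚ b) +ℚ (x *ℚ z)) (+ₚ-eval as bs x) ⟩
  (a +ℚ b) +ℚ (x *ℚ (evalPoly as x +ℚ evalPoly bs x)) ≡⟨ cong ((a +ℚ b) +ℚ_) (ℚₚ.*-distribˡ-+ x _ _) ⟩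
  (a +ℚ b) +ℚ ((x *ℚ evalPoly as x) +ℚ (x *ℚ evalPoly bs x)) ≡⟨ CommutativeSemigroupProperties.interchange +csg a b _ _ ⟩
  (a +ℚ (x *ℚ evalPoly as x)) +ℚ (b +ℚ (x *ℚ evalPoly bs x)) ∎
  where
  open ≡-Reasoning
  +csg : CommutativeSemigroup _ _
  +csg = record { isCommutativeSemigroup = record { isSemigroup = ℚₚ.+-isSemigroup ; comm = ℚₚ.+-comm } }

scale-eval : ∀ a bs x → evalPoly (map (a *ℚ_) bs) x ≡ a *ℚ evalPoly bs x
scale-eval a [] x = sym (ℚₚ.*-zeroʳ a)
scale-eval a (b ∷ bs) x = begin
  (a *ℚ b) +ℚ (x *ℚ evalPoly (map (a *ℚ_) bs) x) ≡⟨ cong (λ z → (a *ℚ b) +ℚ (x *ℚ z)) (scale-eval a bs x) ⟩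
  (a *ℚ b) +ℚ (x *ℚ (a *ℚ evalPoly bs x)) ≡⟨ cong ((a *ℚ b) +ℚ_) (trans (sym (ℚₚ.*-assoc x a _)) (trans (cong (_*ℚ evalPoly bs x) (ℚₚ.*-comm x a)) (ℚₚ.*-assoc a x _))) ⟩
  (a *ℚ b) +ℚ (a *ℚ (x *ℚ evalPoly bs x)) ≡⟨ ℚₚ.*-distribˡ-+ a b _ ⟨
  a *ℚ (b +ℚ (x *ℚ evalPoly bs x)) ∎
  where open ≡-Reasoning

*ₚ-eval : ∀ as bs x → evalPoly (as *ₚ bs) x ≡ evalPoly as x *ℚ evalPoly bs x
*ₚ-eval [] bs x = sym (ℚₚ.*-zeroˡ (evalPoly bs x))
*ₚ-eval (a ∷ as) bs x = begin
  evalPoly (map (a *ℚ_) bs +ₚ (0ℚ ∷ (as *ₚ bs))) x ≡⟨ +ₚ-eval (map (a *ℚ_) bs) _ x ⟩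
  evalPoly (map (a *ℚ_) bs) x +ℚ (0ℚ +ℚ (x *ℚ evalPoly (as *ₚ bs) x)) ≡⟨ cong₂ _+ℚ_ (scale-eval a bs x) (trans (ℚₚ.+-identityˡ _) (trans (cong (x *ℚ_) (*ₚ-eval as bs x)) (sym (ℚₚ.*-assoc x _ _)))) ⟩
  (a *ℚ evalPoly bs x) +ℚ ((x *ℚ evalPoly as x) *ℚ evalPoly bs x) ≡⟨ ℚₚ.*-distribʳ-+ (evalPoly bs x) a _ ⟨
  (a +ℚ (x *ℚ evalPoly as x)) *ℚ evalPoly bs x ∎
  where open ≡-Reasoning

isPolynomial : ∀ e → IsPolynomial ⟦ e ⟧
isPolynomial (con c) = (ℕtoℚ c ∷ []) , λ n → sym (trans (cong (ℕtoℚ c +ℚ_) (ℚₚ.*-zeroʳ (ℕtoℚ n))) (ℚₚ.+-identityʳ _))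
isPolynomial var = (0ℚ ∷ 1ℚ ∷ []) , λ n → sym (begin
  0ℚ +ℚ (ℕtoℚ n *ℚ (1ℚ +ℚ (ℕtoℚ n *ℚ 0ℚ))) ≡⟨ ℚₚ.+-identityˡ _ ⟩
  ℕtoℚ n *ℚ (1ℚ +ℚ (ℕtoℚ n *ℚ 0ℚ)) ≡⟨ cong (λ z → ℕtoℚ n *ℚ (1ℚ +ℚ z)) (ℚₚ.*-zeroʳ (ℕtoℚ n)) ⟩
  ℕtoℚ n *ℚ 1ℚ ≡⟨ ℚₚ.*-identityʳ _ ⟩
  ℕtoℚ n ∎)
  where open ≡-Reasoning
isPolynomial (a ⊕ b) with isPolynomial a | isPolynomial b
... | as , p | bs , q = (as +ₚ bs) , λ n → trans (ℕtoℚ-+ (⟦ a ⟧ n) _) (trans (cong₂ _+ℚ_ (p n) (q n)) (sym (+ₚ-eval as bs _)))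
isPolynomial (a ⊗ b) with isPolynomial a | isPolynomial b
... | as , p | bs , q = (as *ₚ bs) , λ n → trans (ℕtoℚ-* (⟦ a ⟧ n) _) (trans (cong₂ _*ℚ_ (p n) (q n)) (sym (*ₚ-eval as bs _)))

-- Skipping semantics of instruction sequences

Aux : Set
Aux = ℕ → Bool

-- d counts the instructions still to be skipped; forward jumps only make this
-- a structural recursion on the instruction sequence.
scan : ∀ {n} → Vec Bool n → InstrSeq → ℕ → Aux → Bool → Outcome
scan w [] d a o = inaction
scan w (u ∷ X) (suc d) a o = scan w X d a o
scan w (u ∷ X) zero a o with stepAt w (just u) (st 0 a o)
... | finished r = r
... | continue (st p a' o') = scan w X (pred p) a' o'

resume : ∀ {n} → Vec Bool n → InstrSeq → StepResult → Outcome
resume w X (finished r) = r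
resume w X (continue (st p a o)) = scan w X p a o

shift : StepResult → StepResult
shift (finished r) = finished r
shift (continue (st p a o)) = continue (st (suc p) a o)

-- All control flow is relative to the current position, so a run is invariant under translation.
stepAt-shift : ∀ {n} (w : Vec Bool n) mu p a o → stepAt w mu (st (suc p) a o) ≡ shift (stepAt w mu (st p a o))
stepAt-shift w nothing p a o = refl
stepAt-shift w (just (plain b)) p a o with doBasic w b a o
... | nothing = refl
... | just _ = refl
stepAt-shift w (just (ptest b)) p a o with doBasic w b a o
... | nothing = refl
... | just (_ , _ , true) = refl
... | just (_ , _ , false) = refl
stepAt-shift w (just (ntest b)) p a o with doBasic w b a o
... | nothing = refl
... | just (_ , _ , true) = refl
... | just (_ , _ , false) = refl
stepAt-shift w (just (jump zero)) p a o = refl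
stepAt-shift w (just (jump (suc l))) p a o = refl
stepAt-shift w (just halt) p a o = refl

-- The program counter strictly increases. Hence `pred` in `scan` loses nothing, and the length of
-- the sequence bounds the fuel in `run≡scan`.
stepAt-advances : ∀ {n} (w : Vec Bool n) mu p a o {p' a' o'} → stepAt w mu (st p a o) ≡ continue (st p' a' o') → p < p'
stepAt-advances w (just (plain b)) p a o eq with doBasic w b a o
stepAt-advances w (just (plain b)) p a o refl | just _ = ℕₚ.≤-refl
stepAt-advances w (just (ptest b)) p a o eq with doBasic w b a o
stepAt-advances w (just (ptest b)) p a o refl | just (_ , _ , true) = ℕₚ.≤-refl
stepAt-advances w (just (ptest b)) p a o refl | just (_ , _ , false) = ℕₚ.n≤1+n _
stepAt-advances w (just (ntest b)) p a o eq with doBasic w b a o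
stepAt-advances w (just (ntest b)) p a o refl | just (_ , _ , true) = ℕₚ.n≤1+n _
stepAt-advances w (just (ntest b)) p a o refl | just (_ , _ , false) = ℕₚ.≤-refl
stepAt-advances w (just (jump (suc l))) p a o refl = ℕₚ.m<m+n p (s≤s z≤n)

resume-shift : ∀ {n} (w : Vec Bool n) u X r → resume w (u ∷ X) (shift r) ≡ resume w X r
resume-shift w u X (finished _) = refl
resume-shift w u X (continue (st p a o)) = refl

scan-step : ∀ {n} (w : Vec Bool n) X p a o → scan w X p a o ≡ resume w X (stepAt w (fetch X p) (st p a o))
scan-step w [] p a o = refl
scan-step w (u ∷ X) (suc p) a o = trans (scan-step w X p a o)
  (sym (trans (cong (resume w (u ∷ X)) (stepAt-shift w (fetch X p) p a o)) (resume-shift w u X (stepAt w (fetch X p) (st p a o)))))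
scan-step w (u ∷ X) zero a o with stepAt w (just u) (st 0 a o) in eq
... | finished r = refl
... | continue (st p a' o') with stepAt-advances w (just u) 0 a o eq
... | s≤s _ = refl

run⇒scan : ∀ {n} (w : Vec Bool n) X k p a o {b} → run X w k (st p a o) ≡ terminated b → scan w X p a o ≡ terminated b
run⇒scan w X (suc k) p a o eq rewrite scan-step w X p a o with stepAt w (fetch X p) (st p a o)
... | finished r = eq
... | continue (st p' a' o') = run⇒scan w X k p' a' o' eq

fetch-beyond : ∀ X p → length X ≤ p → fetch X p ≡ nothing
fetch-beyond [] p le = refl
fetch-beyond (u ∷ X) (suc p) (s≤s le) = fetch-beyond X p le

-- Every step moves the counter by at least one, so k steps lead past the end; one more unit of fuel
-- lets `run` report the inaction there.
run≡scan : ∀ {n} (w : Vec Bool n) X k p a o → length X ≤ k + p → run X w (suc k) (st p a o) ≡ scan w X p a o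
run≡scan w X zero p a o le rewrite scan-step w X p a o | fetch-beyond X p le = refl
run≡scan w X (suc k) p a o le rewrite scan-step w X p a o with stepAt w (fetch X p) (st p a o) in eq
... | finished r = refl
... | continue (st p' a' o') = run≡scan w X k p' a' o'
  (ℕₚ.≤-trans le (ℕₚ.≤-trans (ℕₚ.≤-reflexive (sym (ℕₚ.+-suc k p))) (ℕₚ.+-monoʳ-≤ k (stepAt-advances w (fetch X p) p a o eq))))

-- The machine checking a column matrix

module Acceptance (M : NTM) where
  open NTM M

  Acc : ℕ → Config M → Set
  Acc t c = ∃ λ c' → ReachWithin M t c c' × Config.state c' ≡ accept

  Acc-mono : ∀ {t t' c} → t ≤ t' → Acc t c → Acc t' c
  Acc-mono le (c' , r , e) = c' , mono le r , e
    where
    mono : ∀ {t t' c c'} → t ≤ t' → ReachWithin M t c c' → ReachWithin M t' c c'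
    mono _ here = here
    mono (s≤s le) (there s r) = there s (mono le r)

  Acc-step : ∀ {t c tr} → tr ∈ δ (Config.state c) (Config.hd c) → Acc t (apply M c tr) → Acc (suc t) c
  Acc-step m (c' , r , e) = c' , there (step _ _ m) r , e

  Acc-inv : ∀ {t c} → Acc t c → Config.state c ≡ accept ⊎
    ∃ λ t' → ∃ λ tr → t ≡ suc t' × tr ∈ δ (Config.state c) (Config.hd c) × Acc t' (apply M c tr)
  Acc-inv (c' , here , e) = inj₁ e
  Acc-inv (c' , there (step _ tr m) r , e) = inj₂ (_ , tr , refl , m , c' , r , e)

  -- `NP` speaks of Boolean-valued functions, so the language of the checker has to be obtained by a
  -- decision procedure.
  acc? : ∀ t c → Dec (Acc t c)
  acc? t c with Config.state c Finₚ.≟ accept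
  ... | yes e = yes (c , here , e)
  acc? zero c | no ne = no λ { (_ , here , e) → ne e }
  acc? (suc t) c | no ne with any? (λ tr → acc? t (apply M c tr)) (δ (Config.state c) (Config.hd c))
  ... | yes p = let tr , m , a = find p in yes (Acc-step m a)
  ... | no np = no λ a → case (Acc-inv a)
    where
    case : _ → ⊥
    case (inj₁ e) = ne e
    case (inj₂ (_ , tr , refl , m , a)) = np (lose m a)

-- A sweep reads one cell per row, updating a flag sat with the bit x guessed for the row; the
-- column is satisfied if sat is true at the end.  P at i and j and Q at g thus state
-- x g ≡ x i ∨ x j, while Q at i and g state x g ≡ not (x i).
data Cell : Set where
  none P Q : Cell

-- `Q` is the equivalence of x and sat: it negates x when sat is still false, and otherwise compares
-- x with the value accumulated so far.
op : Cell → Bool → Bool → Bool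
op none x sat = sat
op P x sat = sat ∨ x
op Q x false = not x
op Q x true = x

-- Every bit pair of the input becomes dead followed by its meaning; processed cells turn dead.
data Mk : Set where
  dead : Mk
  cell : Cell → Mk
  row  : Bool → Mk

data Sy : Set where
  blk : Sy
  bit : Bool → Sy
  mk  : Mk → Sy

-- cur is the bit of the current row, done records that the row has been served in this sweep,
-- any that some row has been.
record PS : Set where
  constructor ps
  field
    sat cur done any : Bool

-- D0, D1: decoding the input, at the first and second bit of a pair; Bk: returning to the left
-- end; Sw: sweeping.
data St : Set where
  D0  : St
  D1  : Bool → St
  Bk  : St
  Acp : St
  Sw  : PS → St

initPS : PS
-- The top row has no marker; it acts as a row with bit true.
initPS = ps false true false false

-- The first live cell after a row marker is consumed and the others are left for later sweeps, so
-- the k-th sweep meets exactly the k-th column.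
pass₁ : PS → Mk → PS × Mk
pass₁ p dead = p , dead
pass₁ (ps sat x d a) (row b) = ps sat b false a , row b
pass₁ (ps sat x true a) (cell c) = ps sat x true a , cell c
pass₁ (ps sat x false a) (cell c) = ps (op c x sat) x true true , dead

δ′ : St → Sy → List (St × Sy × Move)
δ′ D0 (bit b) = (D1 b , mk dead , right) ∷ []
δ′ D0 blk = (Bk , blk , left) ∷ []
δ′ (D1 false) (bit false) = (D0 , mk (cell none) , right) ∷ []
δ′ (D1 true) (bit true) = (D0 , mk (cell P) , right) ∷ []
δ′ (D1 true) (bit false) = (D0 , mk (cell Q) , right) ∷ []
-- The only nondeterministic choice of the machine.
δ′ (D1 false) (bit true) = (D0 , mk (row false) , right) ∷ (D0 , mk (row true) , right) ∷ []
δ′ Bk (mk m) = (Bk , mk m , left) ∷ []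
δ′ Bk blk = (Sw initPS , blk , right) ∷ []
δ′ (Sw p) (mk m) = (Sw (proj₁ (pass₁ p m)) , mk (proj₂ (pass₁ p m)) , right) ∷ []
-- No row had a live cell left, so all columns have been checked.
δ′ (Sw (ps sat x d false)) blk = (Acp , blk , stay) ∷ []
δ′ (Sw (ps true x d true)) blk = (Bk , blk , left) ∷ []
-- Among the blocked cases is the end of a sweep over an unsatisfied column.
δ′ _ _ = []

-- Encoding of states and symbols as finite numbers

encB : Bool → Fin 2
encB false = fz
encB true = fs fz

decB : Fin 2 → Bool
decB fz = false
decB (fs fz) = true

decB-encB : ∀ b → decB (encB b) ≡ b
decB-encB false = refl
decB-encB true = refl

-- Five plain states and 16 combinations of the four sweep flags; `D0` gets number 0, the start
-- state of the machine model.
encS : St → Fin 21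
encS D0 = fz
encS (D1 false) = fs fz
encS (D1 true) = fs (fs fz)
encS Bk = fs (fs (fs fz))
encS Acp = fs (fs (fs (fs fz)))
encS (Sw (ps a b c d)) = 5 ↑ʳ combine (encB a) (combine (encB b) (combine (encB c) (encB d)))

-- Each stage is a named function applied to one `remQuot`, so that `decPS-encPS` can rewrite the
-- stages one after the other by congruence.
decPS : Fin 16 → PS
decPS i = f (remQuot {2} 8 i)
  module decPS where
  h : Fin 2 → Fin 2 → Fin 2 × Fin 2 → PS
  h a b (c , d) = ps (decB a) (decB b) (decB c) (decB d)
  g : Fin 2 → Fin 2 × Fin 4 → PS
  g a (b , i) = h a b (remQuot {2} 2 i)
  f : Fin 2 × Fin 8 → PS
  f (a , i) = g a (remQuot {2} 4 i)

decS : Fin 21 → St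
decS fz = D0
decS (fs fz) = D1 false
decS (fs (fs fz)) = D1 true
decS (fs (fs (fs fz))) = Bk
decS (fs (fs (fs (fs fz)))) = Acp
decS (fs (fs (fs (fs (fs i))))) = Sw (decPS i)

decPS-encPS : ∀ a b c d → decPS (combine (encB a) (combine (encB b) (combine (encB c) (encB d)))) ≡ ps a b c d
decPS-encPS a b c d = begin
  decPS (combine (encB a) i₁)                 ≡⟨ cong (f i₀) (Finₚ.remQuot-combine (encB a) i₁) ⟩
  g i₀ (encB a) (remQuot {2} 4 i₁)            ≡⟨ cong (g i₀ (encB a)) (Finₚ.remQuot-combine (encB b) i₂) ⟩
  h i₀ (encB a) (encB b) (remQuot {2} 2 i₂)   ≡⟨ cong (h i₀ (encB a) (encB b)) (Finₚ.remQuot-combine (encB c) (encB d)) ⟩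
  h i₀ (encB a) (encB b) (encB c , encB d)    ≡⟨ cong₂ (λ a b → ps a b _ _) (decB-encB a) (decB-encB b) ⟩
  ps a b (decB (encB c)) (decB (encB d))   ≡⟨ cong₂ (ps a b) (decB-encB c) (decB-encB d) ⟩
  ps a b c d                               ∎
  where
  open ≡-Reasoning
  open decPS
  i₂ : Fin 4
  i₂ = combine (encB c) (encB d)
  i₁ : Fin 8
  i₁ = combine (encB b) i₂
  i₀ : Fin 16
  i₀ = combine (encB a) i₁

decS-encS : ∀ q → decS (encS q) ≡ q
decS-encS D0 = refl
decS-encS (D1 false) = refl
decS-encS (D1 true) = refl
decS-encS Bk = refl
decS-encS Acp = refl
decS-encS (Sw (ps a b c d)) = cong Sw (decPS-encPS a b c d)

-- The numbers 0, 1 and 2 are prescribed by the machine model for the blank and the two bits; six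
-- work symbols follow.
encY : Sy → Fin 9
encY blk = fz
encY (bit false) = fs fz
encY (bit true) = fs (fs fz)
encY (mk dead) = fs (fs (fs fz))
encY (mk (cell none)) = fs (fs (fs (fs fz)))
encY (mk (cell P)) = fs (fs (fs (fs (fs fz))))
encY (mk (cell Q)) = fs (fs (fs (fs (fs (fs fz)))))
encY (mk (row false)) = fs (fs (fs (fs (fs (fs (fs fz))))))
encY (mk (row true)) = fs (fs (fs (fs (fs (fs (fs (fs fz)))))))

decY : Fin 9 → Sy
decY fz = blk
decY (fs fz) = bit false
decY (fs (fs fz)) = bit true
decY (fs (fs (fs fz))) = mk dead
decY (fs (fs (fs (fs fz)))) = mk (cell none)
decY (fs (fs (fs (fs (fs fz))))) = mk (cell P)
decY (fs (fs (fs (fs (fs (fs fz)))))) = mk (cell Q)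
decY (fs (fs (fs (fs (fs (fs (fs fz))))))) = mk (row false)
decY (fs (fs (fs (fs (fs (fs (fs (fs fz)))))))) = mk (row true)

decY-encY : ∀ s → decY (encY s) ≡ s
decY-encY blk = refl
decY-encY (bit false) = refl
decY-encY (bit true) = refl
decY-encY (mk dead) = refl
decY-encY (mk (cell none)) = refl
decY-encY (mk (cell P)) = refl
decY-encY (mk (cell Q)) = refl
decY-encY (mk (row false)) = refl
decY-encY (mk (row true)) = refl

encT : St × Sy × Move → Fin 21 × Fin 9 × Move
encT (q , s , m) = encS q , encY s , m

checker : NTM
checker = record
  { nstates = 20
  ; nextra = 6
  ; accept = encS Acp
  ; δ = λ q s → map encT (δ′ (decS q) (decY s)) }

-- Runs of the checker

module Checking where
  open Acceptance checker
  open NTM checker using (δ)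

  δ-enc : ∀ q s → δ (encS q) (encY s) ≡ map encT (δ′ q s)
  δ-enc q s rewrite decS-encS q | decY-encY s = refl

  conf : St → List Sy → Sy → List Sy → Config checker
  conf q l s r = cfg (encS q) (map encY l) (encY s) (map encY r)

  focR : St → List Sy → List Sy → Config checker
  focR q l [] = conf q l blk []
  focR q l (s ∷ r) = conf q l s r

  focL : St → List Sy → List Sy → Config checker
  focL q [] r = conf q [] blk r
  focL q (s ∷ l) r = conf q l s r

  target : List Sy → List Sy → St × Sy × Move → Config checker
  target l r (q , s , left) = focL q l (s ∷ r)
  target l r (q , s , right) = focR q (s ∷ l) r
  target l r (q , s , stay) = conf q l s r

  apply-enc : ∀ q l s r tr → apply checker (conf q l s r) (encT tr) ≡ target l r tr
  apply-enc q [] s r (q' , s' , left) = refl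
  apply-enc q (x ∷ l) s r (q' , s' , left) = refl
  apply-enc q l s [] (q' , s' , right) = refl
  apply-enc q l s (x ∷ r) (q' , s' , right) = refl
  apply-enc q l s r (q' , s' , stay) = refl

  A : Config checker → Set
  A c = ∃ λ t → Acc t c

  conf-step : ∀ {t q l s r tr} → tr ∈ δ′ q s → Acc t (target l r tr) → Acc (suc t) (conf q l s r)
  conf-step {t} {q} {l} {s} {r} {tr} m a = Acc-step {c = conf q l s r} {encT tr}
    (subst (encT tr ∈_) (sym (δ-enc q s)) (∈-map m))
    (subst (Acc t) (sym (apply-enc q l s r tr)) a)
    where
    ∈-map : ∀ {xs} → tr ∈ xs → encT tr ∈ map encT xs
    ∈-map (here refl) = here refl
    ∈-map (there i) = there (∈-map i)

  conf-inv : ∀ {q l s r} → q ≢ Acp → A (conf q l s r) → ∃ λ tr → tr ∈ δ′ q s × A (target l r tr)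
  conf-inv {q} {l} {s} {r} ne (t , a) with Acc-inv a
  ... | inj₁ e = ⊥-elim (ne (trans (sym (decS-encS q)) (cong decS e)))
  ... | inj₂ (t' , tr , _ , m , a') with ∈-map⁻ (subst (tr ∈_) (δ-enc q s) m)
    where
    ∈-map⁻ : ∀ {xs} → tr ∈ map encT xs → ∃ λ tr' → tr' ∈ xs × tr ≡ encT tr'
    ∈-map⁻ {x ∷ xs} (here e) = x , here refl , e
    ∈-map⁻ {x ∷ xs} (there i) = let y , j , e = ∈-map⁻ i in y , there j , e
  ... | tr' , m' , refl = tr' , m' , t' , subst (Acc t') (apply-enc q l s r tr') a'

  infix 4 _⟶[_]_
  -- Time is counted in one direction only: completeness has to meet the time bound, while soundness
  -- may start from an accepting run of any length.
  record _⟶[_]_ (c : Config checker) (k : ℕ) (c' : Config checker) : Set where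
    constructor both
    field
      back : ∀ {t} → Acc t c' → Acc (k + t) c
      forth : A c → A c'
  open _⟶[_]_

  ⟶-refl : ∀ {c} → c ⟶[ 0 ] c
  ⟶-refl = both (λ a → a) (λ a → a)

  ⟶-trans : ∀ {c j c' k c''} → c ⟶[ j ] c' → c' ⟶[ k ] c'' → c ⟶[ j + k ] c''
  ⟶-trans {c} {j} {k = k} p q = both (λ {t} a → subst (λ u → Acc u c) (sym (ℕₚ.+-assoc j k t)) (back p (back q a))) (λ a → forth q (forth p a))

  -- With a single transition and a non-accepting state, every accepting run has to continue this
  -- way, which gives `forth`.
  det : ∀ q l s r {tr} → q ≢ Acp → δ′ q s ≡ tr ∷ [] → conf q l s r ⟶[ 1 ] target l r tr
  det q l s r {tr} ne eq = both (conf-step (subst (tr ∈_) (sym eq) (here refl))) fw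
    where
    fw : A (conf q l s r) → A (target l r tr)
    fw a with conf-inv {q} ne a
    ... | tr' , m , a' with subst (tr' ∈_) eq m
    ... | here refl = a'

  stuck : ∀ {q l s r} → q ≢ Acp → δ′ q s ≡ [] → A (conf q l s r) → ⊥
  stuck {q} ne eq a with conf-inv {q} ne a
  ... | tr' , m , a' with subst (tr' ∈_) eq m
  ... | ()

  pass : PS → List Mk → PS × List Mk
  pass p [] = p , []
  pass p (m ∷ ms) = proj₁ rest , proj₂ (pass₁ p m) ∷ proj₂ rest
    where
    rest : PS × List Mk
    rest = pass (proj₁ (pass₁ p m)) ms

  length-pass : ∀ p ms → length (proj₂ (pass p ms)) ≡ length ms
  length-pass p [] = refl
  length-pass p (m ∷ ms) = cong suc (length-pass _ ms)

  sweep-right : ∀ p l ms E → focR (Sw p) l (map mk ms ++ E) ⟶[ length ms ]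
    focR (Sw (proj₁ (pass p ms))) (map mk (proj₂ (pass p ms)) ʳ++ l) E
  sweep-right p l [] E = ⟶-refl
  sweep-right p l (m ∷ ms) E = ⟶-trans (det (Sw p) l (mk m) (map mk ms ++ E) (λ ()) refl) (sweep-right (proj₁ (pass₁ p m)) _ ms E)

  sweep-left : ∀ ms L r → focL Bk (map mk ms ʳ++ L) r ⟶[ length ms ] focL Bk L (map mk ms ++ r)
  sweep-left [] L r = ⟶-refl
  sweep-left (m ∷ ms) L r = subst (focL Bk (map mk ms ʳ++ (mk m ∷ L)) r ⟶[_] focL Bk L (mk m ∷ map mk ms ++ r)) (ℕₚ.+-comm (length ms) 1)
    (⟶-trans (sweep-left ms (mk m ∷ L) r) (det Bk L (mk m) (map mk ms ++ r) (λ ()) refl))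

  start : List Mk → Config checker
  start ms = focR (Sw initPS) (blk ∷ []) (map mk ms ++ blk ∷ [])

  turn : ∀ ms → focL Bk [] (map mk ms ++ blk ∷ []) ⟶[ 1 ] start ms
  turn ms = det Bk [] blk (map mk ms ++ blk ∷ []) (λ ()) refl

  -- After decoding, the blank at the left end is an omitted cell, as in `turn`; after a sweep it is
  -- a stored one.
  turn′ : ∀ ms → focL Bk (blk ∷ []) (map mk ms ++ blk ∷ []) ⟶[ 1 ] start ms
  turn′ ms = det Bk [] blk (map mk ms ++ blk ∷ []) (λ ()) refl

  full-pass : ∀ ms x d {ms'} → pass initPS ms ≡ (ps true x d true , ms') → start ms ⟶[ 2 + (length ms + length ms) ] start ms'
  full-pass ms x d {ms'} eq = subst (start ms ⟶[_] start ms') arith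
    (⟶-trans (sweep-right initPS (blk ∷ []) ms (blk ∷ [])) (subst (λ z → focR (Sw (proj₁ z)) (map mk (proj₂ z) ʳ++ (blk ∷ [])) (blk ∷ []) ⟶[ 1 + (length ms' + 1) ] start ms') (sym eq)
      (⟶-trans (det (Sw (ps true x d true)) (map mk ms' ʳ++ (blk ∷ [])) blk [] (λ ()) refl) (⟶-trans (sweep-left ms' (blk ∷ []) (blk ∷ [])) (turn′ ms')))))
    where
    len : length ms' ≡ length ms
    len = trans (cong (length ∘ proj₂) (sym eq)) (length-pass initPS ms)
    arith : length ms + (1 + (length ms' + 1)) ≡ 2 + (length ms + length ms)
    arith rewrite len | ℕₚ.+-comm (length ms) 1 | ℕₚ.+-suc (length ms) (suc (length ms)) | ℕₚ.+-suc (length ms) (length ms) = refl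

  failing-pass : ∀ ms x d {ms'} → pass initPS ms ≡ (ps false x d true , ms') → A (start ms) → ⊥
  failing-pass ms x d {ms'} eq a = stuck {Sw (ps false x d true)} {map mk ms' ʳ++ (blk ∷ [])} {blk} {[]} (λ ()) refl
    (subst (λ z → A (focR (Sw (proj₁ z)) (map mk (proj₂ z) ʳ++ (blk ∷ [])) (blk ∷ []))) eq (forth (sweep-right initPS (blk ∷ []) ms (blk ∷ [])) a))

  final-pass : ∀ ms s x d {ms'} → pass initPS ms ≡ (ps s x d false , ms') → Acc (length ms + 1) (start ms)
  final-pass ms s x d {ms'} eq = back (sweep-right initPS (blk ∷ []) ms (blk ∷ []))
    (subst (λ z → Acc 1 (focR (Sw (proj₁ z)) (map mk (proj₂ z) ʳ++ (blk ∷ [])) (blk ∷ []))) (sym eq)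
      (conf-step {q = Sw (ps s x d false)} {l = map mk ms' ʳ++ (blk ∷ [])} {r = []} (here refl) (_ , ReachWithin.here , refl)))

  -- Decoding of the input

  data Tok : Set where
    cell : Cell → Tok
    mark : Tok

  -- `pair` dictates three of the codes: doubled input bits are 00 and 11, the separator is 01.
  tokBits : Tok → List Bool
  tokBits (cell none) = false ∷ false ∷ []
  tokBits (cell P) = true ∷ true ∷ []
  tokBits (cell Q) = true ∷ false ∷ []
  tokBits mark = false ∷ true ∷ []

  bits : List Tok → List Bool
  bits = concatMap tokBits

  word : List Tok → (ℕ → Bool) → List Mk
  word [] x = []
  word (cell c ∷ ts) x = dead ∷ cell c ∷ word ts x
  word (mark ∷ ts) x = dead ∷ row (x 0) ∷ word ts (x ∘ suc)

  length-word : ∀ ts x → length (word ts x) ≡ length (bits ts)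
  length-word [] x = refl
  length-word (cell none ∷ ts) x = cong (2 +_) (length-word ts x)
  length-word (cell P ∷ ts) x = cong (2 +_) (length-word ts x)
  length-word (cell Q ∷ ts) x = cong (2 +_) (length-word ts x)
  length-word (mark ∷ ts) x = cong (2 +_) (length-word ts (x ∘ suc))

  decode-cell : ∀ c l r → focR D0 l (map bit (tokBits (cell c)) ++ r) ⟶[ 2 ] focR D0 (mk (cell c) ∷ mk dead ∷ l) r
  decode-cell none l r = ⟶-trans (det D0 l (bit false) (bit false ∷ r) (λ ()) refl) (det (D1 false) (mk dead ∷ l) (bit false) r (λ ()) refl)
  decode-cell P l r = ⟶-trans (det D0 l (bit true) (bit true ∷ r) (λ ()) refl) (det (D1 true) (mk dead ∷ l) (bit true) r (λ ()) refl)
  decode-cell Q l r = ⟶-trans (det D0 l (bit true) (bit false ∷ r) (λ ()) refl) (det (D1 true) (mk dead ∷ l) (bit false) r (λ ()) refl)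

  map-bits-cell : ∀ t ts → map bit (bits (t ∷ ts)) ≡ map bit (tokBits t) ++ map bit (bits ts)
  map-bits-cell t ts = Listₚ.map-++ bit (tokBits t) (bits ts)

  length-tokBits : ∀ t → length (tokBits t) ≡ 2
  length-tokBits (cell none) = refl
  length-tokBits (cell P) = refl
  length-tokBits (cell Q) = refl
  length-tokBits mark = refl

  guess-step : ∀ {t} b l r → Acc t (focR D0 (mk (row b) ∷ mk dead ∷ l) r) → Acc (2 + t) (focR D0 l (map bit (tokBits mark) ++ r))
  guess-step b l r a = back (det D0 l (bit false) (bit true ∷ r) (λ ()) refl)
    (conf-step {q = D1 false} {mk dead ∷ l} {bit true} {r} {D0 , mk (row b) , right} (m b) a)
    where
    m : ∀ b → (D0 , mk (row b) , right) ∈ δ′ (D1 false) (bit true)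
    m false = here refl
    m true = there (here refl)

  decode-complete : ∀ ts x l {t} → Acc t (focR D0 (map mk (word ts x) ʳ++ l) []) →
    Acc (length (bits ts) + t) (focR D0 l (map bit (bits ts)))
  decode-complete [] x l a = a
  decode-complete (cell c ∷ ts) x l {t} a = subst₂ Acc
    (cong (_+ t) (sym (trans (Listₚ.length-++ (tokBits (cell c))) (cong (_+ length (bits ts)) (length-tokBits (cell c))))))
    (cong (focR D0 l) (sym (map-bits-cell (cell c) ts)))
    (back (decode-cell c l (map bit (bits ts))) (decode-complete ts x _ a))
  decode-complete (mark ∷ ts) x l a = guess-step (x 0) l (map bit (bits ts)) (decode-complete ts (x ∘ suc) _ a)

  decode-sound : ∀ ts l → A (focR D0 l (map bit (bits ts))) → ∃ λ x → A (focR D0 (map mk (word ts x) ʳ++ l) [])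
  -- No marker is left to receive a bit, so the remaining bits get a default value.
  decode-sound [] l a = (λ _ → false) , a
  decode-sound (cell c ∷ ts) l a = decode-sound ts _
    (forth (decode-cell c l (map bit (bits ts))) (subst A (cong (focR D0 l) (map-bits-cell (cell c) ts)) a))
  decode-sound (mark ∷ ts) l a
    with conf-inv {D1 false} {mk dead ∷ l} {bit true} {map bit (bits ts)} (λ ()) (forth (det D0 l (bit false) (bit true ∷ map bit (bits ts)) (λ ()) refl) a)
  ... | _ , here refl , a' = let x , b = decode-sound ts _ a' in (λ { zero → false ; (suc i) → x i }) , b
  ... | _ , there (here refl) , a' = let x , b = decode-sound ts _ a' in (λ { zero → true ; (suc i) → x i }) , b

  decoded-start : ∀ ms → focR D0 (map mk ms ʳ++ []) [] ⟶[ 2 + length ms ] start ms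
  decoded-start ms = subst (focR D0 (map mk ms ʳ++ []) [] ⟶[_] start ms) (cong suc (ℕₚ.+-comm (length ms) 1))
    (⟶-trans (det D0 (map mk ms ʳ++ []) blk [] (λ ()) refl) (⟶-trans (sweep-left ms [] (blk ∷ [])) (turn ms)))

  initConfig-focR : ∀ bs → initConfig checker bs ≡ focR D0 [] (map bit bs)
  initConfig-focR [] = refl
  initConfig-focR (b ∷ bs) = cong₂ (λ s r → cfg _ [] s r) (enc b) (trans (Listₚ.map-cong enc bs) (Listₚ.map-∘ bs))
    where
    enc : ∀ b → bitSym checker b ≡ encY (bit b)
    enc false = refl
    enc true = refl

  strip : List Mk → List Mk
  strip [] = []
  strip (dead ∷ ms) = strip ms
  strip (cell c ∷ ms) = cell c ∷ strip ms
  strip (row b ∷ ms) = row b ∷ strip ms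

  -- Dead cells affect neither the flags nor the other cells, so sweeps can be analysed on the bare
  -- matrix although the tape never shrinks.
  pass-strip : ∀ p ms → proj₁ (pass p ms) ≡ proj₁ (pass p (strip ms)) ×
    strip (proj₂ (pass p ms)) ≡ strip (proj₂ (pass p (strip ms)))
  pass-strip p [] = refl , refl
  pass-strip p (dead ∷ ms) = pass-strip p ms
  pass-strip (ps s x false a) (cell c ∷ ms) = pass-strip _ ms
  pass-strip (ps s x true a) (cell c ∷ ms) = let e , f = pass-strip _ ms in e , cong (cell c ∷_) f
  pass-strip (ps s x d a) (row b ∷ ms) = let e , f = pass-strip _ ms in e , cong (row b ∷_) f

-- Column matrices

  Column : Set
  Column = ℕ → Cell

  foldR : Column → (ℕ → Bool) → ℕ → ℕ → Bool → Bool
  foldR col x zero i s = s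
  foldR col x (suc k) i s = foldR col x k (suc i) (op (col i) (x i) s)

  headBit : List Bool → Bool
  headBit [] = false
  headBit (b ∷ w) = b

  -- The top row hands one bit of w to each column as the initial value of the flag; once w is
  -- exhausted, columns start from false.
  AllSat : List Bool → List Column → (ℕ → Bool) → ℕ → Set
  AllSat w [] x G = ⊤
  AllSat w (col ∷ cols) x G = foldR col x G 0 (headBit w) ≡ true × AllSat (drop 1 w) cols x G

  -- On the top row, where x is true, this cell sets sat to the input bit.
  bitCell : Bool → Cell
  bitCell true = P
  bitCell false = none

  rowCells : List Column → ℕ → List Cell
  rowCells cols i = map (λ col → col i) cols

  rowToks : List Column → ℕ → ℕ → List Tok
  rowToks cols zero i = []
  rowToks cols (suc k) i = mark ∷ map cell (rowCells cols i) ++ rowToks cols k (suc i)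

  rowMks : List Column → (ℕ → Bool) → ℕ → ℕ → List Mk
  rowMks cols x zero i = []
  rowMks cols x (suc k) i = row (x i) ∷ map cell (rowCells cols i) ++ rowMks cols x k (suc i)

  -- The cells of w form the unmarked top row, and `row y` is the separator of `pair` together with
  -- the bit guessed at it.
  matrix : List Bool → List Column → Bool → (ℕ → Bool) → ℕ → List Mk
  matrix w cols y x G = map (cell ∘ bitCell) w ++ row y ∷ rowMks cols x G 0

  strip-cells : ∀ cs ms → strip (map cell cs ++ ms) ≡ map cell cs ++ strip ms
  strip-cells [] ms = refl
  strip-cells (c ∷ cs) ms = cong (cell c ∷_) (strip-cells cs ms)

  strip-rowMks : ∀ cols x k i → strip (rowMks cols x k i) ≡ rowMks cols x k i
  strip-rowMks cols x zero i = refl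
  strip-rowMks cols x (suc k) i = cong (row (x i) ∷_)
    (trans (strip-cells (rowCells cols i) _) (cong (map cell (rowCells cols i) ++_) (strip-rowMks cols x k (suc i))))

  pass-done : ∀ s x a cs ms → pass (ps s x true a) (map cell cs ++ ms) ≡
    (proj₁ (pass (ps s x true a) ms) , map cell cs ++ proj₂ (pass (ps s x true a) ms))
  pass-done s x a [] ms = refl
  pass-done s x a (c ∷ cs) ms rewrite pass-done s x a cs ms = refl

  positive : ℕ → Bool
  positive zero = false
  positive (suc _) = true

  open PS

  pass-rowMks : ∀ col cols x k i s c d a →
    let r = pass (ps s c d a) (rowMks (col ∷ cols) x k i) in
    sat (proj₁ r) ≡ foldR col x k i s × any (proj₁ r) ≡ a ∨ positive k × strip (proj₂ r) ≡ rowMks cols x k i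
  pass-rowMks col cols x zero i s c d a = refl , sym (Boolₚ.∨-identityʳ a) , refl
  pass-rowMks col cols x (suc k) i s c d a
    rewrite pass-done (op (col i) (x i) s) (x i) true (rowCells cols i) (rowMks (col ∷ cols) x k (suc i))
    = let e , f , g = pass-rowMks col cols x k (suc i) (op (col i) (x i) s) (x i) true true in
      e , trans f (sym (Boolₚ.∨-zeroʳ a)) ,
      cong (row (x i) ∷_) (trans (strip-cells (rowCells cols i) _) (cong (map cell (rowCells cols i) ++_) g))

  pass-rowMks-[] : ∀ x k i s c d a → any (proj₁ (pass (ps s c d a) (rowMks [] x k i))) ≡ a
  pass-rowMks-[] x zero i s c d a = refl
  pass-rowMks-[] x (suc k) i s c d a = pass-rowMks-[] x k (suc i) s (x i) false a

  op-bitCell : ∀ b → op (bitCell b) true false ≡ b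
  op-bitCell false = refl
  op-bitCell true = refl

  -- A sweep peels off the first column. The condition on G guarantees a live cell even when w is
  -- empty, so that this sweep is not taken for the final one.
  pass-matrix-∷ : ∀ w col cols y x G → 0 < G →
    let r = pass initPS (matrix w (col ∷ cols) y x G) in
    sat (proj₁ r) ≡ foldR col x G 0 (headBit w) × any (proj₁ r) ≡ true × strip (proj₂ r) ≡ matrix (drop 1 w) cols y x G
  pass-matrix-∷ [] col cols y x (suc G) _ =
    let e , f , g = pass-rowMks col cols x (suc G) 0 false y false false in e , f , cong (row y ∷_) g
  pass-matrix-∷ (b ∷ w) col cols y x G _
    rewrite Listₚ.map-∘ {g = Mk.cell} {f = bitCell} w
          | pass-done (op (bitCell b) true false) true true (map bitCell w) (row y ∷ rowMks (col ∷ cols) x G 0)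
          | op-bitCell b
    = let e , f , g = pass-rowMks col cols x G 0 b y false true in
      e , f , trans (strip-cells (map bitCell w) _) (cong (λ z → map cell (map bitCell w) ++ row y ∷ z) g)

  module _ (y : Bool) (x : ℕ → Bool) (G : ℕ) (0<G : 0 < G) where

    passTime : ℕ → ℕ
    passTime n = 2 + (n + n)

    -- Each column costs one full sweep. The bound on w makes the top row run out no later than the
    -- others, so the sweep after the last column finds no live cell and accepts.
    pass-accept : ∀ cols w ms → length w ≤ length cols → strip ms ≡ matrix w cols y x G → AllSat w cols x G →
      Acc (length cols * passTime (length ms) + (length ms + 1)) (start ms)
    pass-accept [] [] ms _ eq _ with pass initPS ms in eq' | pass-strip initPS ms
    ... | ps s c d true , ms' | e , _ = ⊥-elim (true≢false (trans (cong any e) (trans (cong (λ z → any (proj₁ (pass initPS z))) eq) (pass-rowMks-[] x G 0 false y false false))))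
      where
      true≢false : true ≡ false → ⊥
      true≢false ()
    ... | ps s c d false , ms' | _ = final-pass ms s c d eq'
    pass-accept (col ∷ cols) w ms le eq (s≡ , rest) with pass initPS ms in eq' | pass-strip initPS ms | pass-matrix-∷ w col cols y x G 0<G
    ... | ps s c d a , ms' | e , f | e' , a' , f' rewrite eq with trans (cong sat e) (trans e' s≡) | trans (cong any e) a'
    ... | refl | refl = subst (λ t → Acc t (start ms)) (sym (ℕₚ.+-assoc (passTime (length ms)) (length cols * passTime (length ms)) (length ms + 1)))
      (back (full-pass ms c d eq') (subst (λ n → Acc (length cols * passTime n + (n + 1)) (start ms'))
        (trans (cong (length ∘ proj₂) (sym eq')) (length-pass initPS ms))
        (pass-accept cols (drop 1 w) ms' (le' w le) (trans f f') rest)))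
      where
      le' : ∀ w → length w ≤ suc (length cols) → length (drop 1 w) ≤ length cols
      le' [] _ = z≤n
      le' (_ ∷ w) (s≤s p) = p

    pass-reflect : ∀ cols w ms → strip ms ≡ matrix w cols y x G → A (start ms) → AllSat w cols x G
    pass-reflect [] w ms eq acc = tt
    pass-reflect (col ∷ cols) w ms eq acc with pass initPS ms in eq' | pass-strip initPS ms | pass-matrix-∷ w col cols y x G 0<G
    ... | ps s c d a , ms' | e , f | e' , a' , f' rewrite eq with trans (cong any e) a'
    pass-reflect (col ∷ cols) w ms eq acc | ps true c d a , ms' | e , f | e' , a' , f' | refl =
      trans (sym e') (sym (cong sat e)) , pass-reflect cols (drop 1 w) ms' (trans f f') (forth (full-pass ms c d eq') acc)
    pass-reflect (col ∷ cols) w ms eq acc | ps false c d a , ms' | e , f | e' , a' , f' | refl = ⊥-elim (failing-pass ms c d eq' acc)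

  advice : List Column → ℕ → List Bool
  advice cols G = bits (rowToks cols G 0)

  -- The separator 01 of pair reads as a marker and so opens an empty row.
  inputToks : List Bool → List Column → ℕ → List Tok
  inputToks w cols G = map (cell ∘ bitCell) w ++ mark ∷ rowToks cols G 0

  pair-toks : ∀ w cols G → pair w (advice cols G) ≡ bits (inputToks w cols G)
  pair-toks [] cols G = refl
  pair-toks (false ∷ w) cols G = cong (λ z → false ∷ false ∷ z) (pair-toks w cols G)
  pair-toks (true ∷ w) cols G = cong (λ z → true ∷ true ∷ z) (pair-toks w cols G)

  strip-word-cells : ∀ cs ts x → strip (word (map cell cs ++ ts) x) ≡ map cell cs ++ strip (word ts x)
  strip-word-cells [] ts x = refl
  strip-word-cells (c ∷ cs) ts x = cong (cell c ∷_) (strip-word-cells cs ts x)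

  strip-word-rowToks : ∀ cols k i x y → (∀ t → y t ≡ x (i + t)) → strip (word (rowToks cols k i) y) ≡ rowMks cols x k i
  strip-word-rowToks cols zero i x y h = refl
  strip-word-rowToks cols (suc k) i x y h = cong₂ _∷_ (cong row (trans (h 0) (cong x (ℕₚ.+-identityʳ i))))
    (trans (strip-word-cells (rowCells cols i) _ _)
      (cong (map cell (rowCells cols i) ++_) (strip-word-rowToks cols k (suc i) x (y ∘ suc) (λ t → trans (h (suc t)) (cong x (ℕₚ.+-suc i t))))))

  strip-word-inputToks : ∀ w cols G x → strip (word (inputToks w cols G) x) ≡ matrix w cols (x 0) (x ∘ suc) G
  strip-word-inputToks w cols G x rewrite Listₚ.map-∘ {g = Tok.cell} {f = bitCell} w | Listₚ.map-∘ {g = Mk.cell} {f = bitCell} w =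
    trans (strip-word-cells (map bitCell w) _ x) (cong (λ z → map cell (map bitCell w) ++ row (x 0) ∷ z)
      (strip-word-rowToks cols G 0 (x ∘ suc) (x ∘ suc) (λ t → refl)))

  length-bits-∷ : ∀ t ts → length (bits (t ∷ ts)) ≡ 2 + length (bits ts)
  length-bits-∷ t ts = trans (Listₚ.length-++ (tokBits t)) (cong (_+ length (bits ts)) (length-tokBits t))

  length-bits : ∀ ts → length (bits ts) ≡ length ts + length ts
  length-bits [] = refl
  length-bits (t ∷ ts) = trans (length-bits-∷ t ts) (trans (cong (2 +_) (length-bits ts)) (cong suc (sym (ℕₚ.+-suc (length ts) (length ts)))))

  length-rowToks : ∀ cols k i → length (rowToks cols k i) ≡ k * suc (length cols)
  length-rowToks cols zero i = refl
  length-rowToks cols (suc k) i = cong suc (trans (Listₚ.length-++ (map cell (rowCells cols i)))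
    (cong₂ _+_ (trans (Listₚ.length-map cell (rowCells cols i)) (Listₚ.length-map _ cols)) (length-rowToks cols k (suc i))))

  length-advice : ∀ cols G → length (advice cols G) ≡ G * suc (length cols) + G * suc (length cols)
  length-advice cols G = trans (length-bits (rowToks cols G 0)) (cong₂ _+_ (length-rowToks cols G 0) (length-rowToks cols G 0))

  -- For an input of length N: N steps of decoding, N + 2 to return and turn, at most N sweeps of 2N
  -- + 2 steps, and N + 1 for the accepting sweep. Adding N + 1 makes the sum factor.
  timeBound : Poly
  timeBound = (var ⊕ var ⊕ con 2) ⊗ (var ⊕ con 2)

  -- A single row already spells out one cell for every column.
  cols≤input : ∀ w cols G → 0 < G → length cols ≤ length (bits (inputToks w cols G))
  cols≤input w cols (suc G) _ = begin
    length cols                               ≤⟨ ℕₚ.n≤1+n _ ⟩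
    suc (length cols)                         ≤⟨ ℕₚ.m≤m+n _ _ ⟩
    suc G * suc (length cols)                 ≡⟨ length-rowToks cols (suc G) 0 ⟨
    length (rowToks cols (suc G) 0)           ≤⟨ ℕₚ.n≤1+n _ ⟩
    length (mark ∷ rowToks cols (suc G) 0)    ≤⟨ ℕₚ.m≤n+m _ _ ⟩
    length (map (Tok.cell ∘ bitCell) w) + length (mark ∷ rowToks cols (suc G) 0) ≡⟨ Listₚ.length-++ (map (Tok.cell ∘ bitCell) w) ⟨
    length ts                                 ≤⟨ ℕₚ.m≤m+n _ _ ⟩
    length ts + length ts                     ≡⟨ length-bits ts ⟨
    length (bits ts)                          ∎
    where
    open ℕₚ.≤-Reasoning
    ts : List Tok
    ts = inputToks w cols (suc G)

  checker-accepts : ∀ w cols G → 0 < G → length w ≤ length cols →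
    AcceptsWithin checker (pair w (advice cols G)) (⟦ timeBound ⟧ (length (pair w (advice cols G)))) ⇔
    (∃ λ x → AllSat w cols x G)
  checker-accepts w cols G 0<G w≤cols rewrite pair-toks w cols G | initConfig-focR (bits (inputToks w cols G)) = mk⇔ sound complete
    where
    ts : List Tok
    ts = inputToks w cols G
    N : ℕ
    N = length (bits ts)
    sound : Acc (⟦ timeBound ⟧ N) (focR D0 [] (map bit (bits ts))) → ∃ λ x → AllSat w cols x G
    sound acc = let x , acc' = decode-sound ts [] (_ , acc) in
      x ∘ suc , pass-reflect (x 0) (x ∘ suc) G 0<G cols w (word ts x) (strip-word-inputToks w cols G x)
        (forth (decoded-start (word ts x)) acc')
    complete : (∃ λ x → AllSat w cols x G) → Acc (⟦ timeBound ⟧ N) (focR D0 [] (map bit (bits ts)))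
    complete (x , sat) = Acc-mono time (decode-complete ts x' [] (back (decoded-start (word ts x'))
        (pass-accept false x G 0<G cols w (word ts x') w≤cols (strip-word-inputToks w cols G x') sat)))
      where
      x' : ℕ → Bool
      -- The marker read from the separator of `pair` takes the first guess; in `sound` the
      -- composition with `suc` removes it again.
      x' zero = false
      x' (suc i) = x i
      L : ℕ
      L = length (word ts x')
      open ℕₚ.≤-Reasoning
      time : N + (2 + L + (length cols * (2 + (L + L)) + (L + 1))) ≤ ⟦ timeBound ⟧ N
      time rewrite length-word ts x' = begin
        N + (2 + N + (length cols * (2 + (N + N)) + (N + 1))) ≤⟨ ℕₚ.+-monoʳ-≤ N (ℕₚ.+-monoʳ-≤ (2 + N) (ℕₚ.+-monoˡ-≤ (N + 1) (ℕₚ.*-monoˡ-≤ (2 + (N + N)) (cols≤input w cols G 0<G)))) ⟩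
        N + (2 + N + (N * (2 + (N + N)) + (N + 1))) ≤⟨ ℕₚ.m≤m+n _ (N + 1) ⟩
        N + (2 + N + (N * (2 + (N + N)) + (N + 1))) + (N + 1) ≡⟨ solve 1 (λ N → N :+ (con 2 :+ N :+ (N :* (con 2 :+ (N :+ N)) :+ (N :+ con 1))) :+ (N :+ con 1)
             := (N :+ N :+ con 2) :* (N :+ con 2)) refl N ⟩
        (N + N + 2) * (N + 2) ∎
        where
          open +-*-Solver

open Checking using (Column; foldR; headBit; AllSat; advice; length-advice; timeBound; checker-accepts)

-- Circuits

module _ {A : Set} where

  infix 4 _⊑_
  -- Lists grow at the head, so the older list is a suffix. Wire numbers and code labels are both
  -- counted from the end and therefore survive growth.
  data _⊑_ (xs : List A) : List A → Set where
    ⊑-refl : xs ⊑ xs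
    ⊑-cons : ∀ {y ys} → xs ⊑ ys → xs ⊑ y ∷ ys

  ⊑-trans : ∀ {xs ys zs} → xs ⊑ ys → ys ⊑ zs → xs ⊑ zs
  ⊑-trans p ⊑-refl = p
  ⊑-trans p (⊑-cons q) = ⊑-cons (⊑-trans p q)

  ⊑-length : ∀ {xs ys} → xs ⊑ ys → length xs ≤ length ys
  ⊑-length ⊑-refl = ℕₚ.≤-refl
  ⊑-length (⊑-cons p) = ℕₚ.m≤n⇒m≤1+n (⊑-length p)

  -- A graded state monad: k bounds how much the list grows, so the types of the constructions carry
  -- their size bounds. It serves circuits as well as instruction sequences.
  record Build (k : ℕ) (xs : List A) (R : List A → Set) : Set where
    constructor built
    field
      {list} : List A
      ext : xs ⊑ list
      size : length list ≤ k + length xs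
      result : R list

  return : ∀ {xs R} → R xs → Build 0 xs R
  return r = built ⊑-refl ℕₚ.≤-refl r

  infixl 1 _>>=_
  _>>=_ : ∀ {j k xs R S} → Build j xs R → (∀ {ys} → xs ⊑ ys → R ys → Build k ys S) → Build (j + k) xs S
  _>>=_ {j} {k} {xs} (built {ys} e s r) f with f e r
  ... | built {zs} e' s' r' = built (⊑-trans e e') le r'
    where
    open ℕₚ.≤-Reasoning
    le : length zs ≤ j + k + length xs
    le = begin
      length zs             ≤⟨ s' ⟩
      k + length ys         ≤⟨ ℕₚ.+-monoʳ-≤ k s ⟩
      k + (j + length xs)   ≡⟨ ℕₚ.+-assoc k j (length xs) ⟨
      k + j + length xs     ≡⟨ cong (_+ length xs) (ℕₚ.+-comm k j) ⟩
      j + k + length xs     ∎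

  weaken : ∀ {j k xs R} → j ≤ k → Build j xs R → Build k xs R
  weaken {xs = xs} le (built e s r) = built e (ℕₚ.≤-trans s (ℕₚ.+-monoˡ-≤ (length xs) le)) r

  map-result : ∀ {k xs R S} → (∀ {ys} → R ys → S ys) → Build k xs R → Build k xs S
  map-result f (built e s r) = built e s (f r)

foldR-snoc : ∀ col x k i s → foldR col x (suc k) i s ≡ op (col (k + i)) (x (k + i)) (foldR col x k i s)
foldR-snoc col x zero i s = refl
foldR-snoc col x (suc k) i s = trans (foldR-snoc col x k (suc i) (op (col i) (x i) s))
  (cong (λ j → op (col j) (x j) (foldR col x k (suc i) (op (col i) (x i) s))) (ℕₚ.+-suc k i))

foldR-suc : ∀ col x k s → foldR col x (suc k) 0 s ≡ op (col k) (x k) (foldR col x k 0 s)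
foldR-suc col x k s = trans (foldR-snoc col x k 0 s) (cong (λ j → op (col j) (x j) (foldR col x k 0 s)) (ℕₚ.+-identityʳ k))

foldR-cong : ∀ {col col' x x'} k s → (∀ {j} → j < k → col j ≡ col' j × x j ≡ x' j) → foldR col x k 0 s ≡ foldR col' x' k 0 s
foldR-cong zero s h = refl
foldR-cong {col} {col'} {x} {x'} (suc k) s h = begin
  foldR col x (suc k) 0 s                      ≡⟨ foldR-suc col x k s ⟩
  op (col k) (x k) (foldR col x k 0 s)         ≡⟨ cong₂ (λ c b → op c b (foldR col x k 0 s)) (proj₁ (h ℕₚ.≤-refl)) (proj₂ (h ℕₚ.≤-refl)) ⟩
  op (col' k) (x' k) (foldR col x k 0 s)       ≡⟨ cong (op (col' k) (x' k)) (foldR-cong k s (λ lt → h (ℕₚ.m<n⇒m<1+n lt))) ⟩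
  op (col' k) (x' k) (foldR col' x' k 0 s)     ≡⟨ foldR-suc col' x' k s ⟨
  foldR col' x' (suc k) 0 s                    ∎
  where open ≡-Reasoning

foldR-none : ∀ x k s → foldR (λ _ → none) x k 0 s ≡ s
foldR-none x zero s = refl
foldR-none x (suc k) s = trans (foldR-suc (λ _ → none) x k s) (foldR-none x k s)

-- With c = Q: the column stating that wire k carries the value of gate g on the wires below k.
truncate : Column → Cell → ℕ → Column
truncate g c k i with ℕₚ.<-cmp i k
... | tri< _ _ _ = g i
... | tri≈ _ _ _ = c
... | tri> _ _ _ = none

truncate-< : ∀ g c k {i} → i < k → truncate g c k i ≡ g i
truncate-< g c k {i} lt with ℕₚ.<-cmp i k
... | tri< _ _ _ = refl
... | tri≈ ¬lt _ _ = ⊥-elim (¬lt lt)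
... | tri> ¬lt _ _ = ⊥-elim (¬lt lt)

truncate-≡ : ∀ g c k → truncate g c k k ≡ c
truncate-≡ g c k with ℕₚ.<-cmp k k
... | tri< _ ne _ = ⊥-elim (ne refl)
... | tri≈ _ _ _ = refl
... | tri> _ ne _ = ⊥-elim (ne refl)

truncate-> : ∀ g c k {i} → k < i → truncate g c k i ≡ none
truncate-> g c k {i} gt with ℕₚ.<-cmp i k
... | tri< _ _ ¬gt = ⊥-elim (¬gt gt)
... | tri≈ _ _ ¬gt = ⊥-elim (¬gt gt)
... | tri> _ _ _ = refl

foldR-truncate : ∀ g c k x G s → k < G → foldR (truncate g c k) x G 0 s ≡ op c (x k) (foldR g x k 0 s)
foldR-truncate g c k x (suc G) s k<G with ℕₚ.m≤n⇒m<n∨m≡n (ℕₚ.≤-pred k<G)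
... | inj₁ k<G' = trans (foldR-suc (truncate g c k) x G s)
  (trans (cong (λ z → op z (x G) (foldR (truncate g c k) x G 0 s)) (truncate-> g c k k<G')) (foldR-truncate g c k x G s k<G'))
... | inj₂ refl = trans (foldR-suc (truncate g c k) x k s)
  (cong₂ (λ z t → op z (x k) t) (truncate-≡ g c k) (foldR-cong k s (λ lt → truncate-< g c k lt , refl)))

<ᵇ-suc : ∀ a k → (a <ᵇ suc k) ≡ (a ≡ᵇ k) ∨ (a <ᵇ k)
<ᵇ-suc zero zero = refl
<ᵇ-suc zero (suc k) = refl
<ᵇ-suc (suc a) zero = refl
<ᵇ-suc (suc a) (suc k) = <ᵇ-suc a k

<ᵇ-irrefl : ∀ a → (a <ᵇ a) ≡ false
<ᵇ-irrefl zero = refl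
<ᵇ-irrefl (suc a) = <ᵇ-irrefl a

<⇒<ᵇ-true : ∀ {a k} → a < k → (a <ᵇ k) ≡ true
<⇒<ᵇ-true {zero} {suc k} _ = refl
<⇒<ᵇ-true {suc a} {suc k} (s≤s lt) = <⇒<ᵇ-true lt

orCol : ℕ → ℕ → Column
orCol a b i = if (a ≡ᵇ i) ∨ (b ≡ᵇ i) then P else none

notCol : ℕ → Column
notCol a i = if a ≡ᵇ i then Q else none

-- The guards carry the induction: a wire contributes once its row has been passed. The two wires
-- may coincide, and then a single `P` stands for both.
foldR-orCol : ∀ a b x k → foldR (orCol a b) x k 0 false ≡ ((a <ᵇ k) ∧ x a) ∨ ((b <ᵇ k) ∧ x b)
foldR-orCol a b x zero = refl
foldR-orCol a b x (suc k) rewrite foldR-suc (orCol a b) x k false | foldR-orCol a b x k | <ᵇ-suc a k | <ᵇ-suc b k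
  with a ≡ᵇ k in a≡k | b ≡ᵇ k in b≡k
... | false | false = refl
... | true | false rewrite ℕₚ.≡ᵇ⇒≡ a k (subst T (sym a≡k) tt) = lem (k <ᵇ k) (x k) ((b <ᵇ k) ∧ x b)
  where
  lem : ∀ l y r → ((l ∧ y) ∨ r) ∨ y ≡ y ∨ r
  lem false y r = Boolₚ.∨-comm r y
  lem true false r = Boolₚ.∨-identityʳ r
  lem true true r = refl
... | false | true rewrite ℕₚ.≡ᵇ⇒≡ b k (subst T (sym b≡k) tt) = lem (k <ᵇ k) (x k) ((a <ᵇ k) ∧ x a)
  where
  lem : ∀ l y r → (r ∨ (l ∧ y)) ∨ y ≡ r ∨ y
  lem false y false = refl
  lem false y true = refl
  lem true y false = Boolₚ.∨-idem y
  lem true y true = refl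
... | true | true rewrite ℕₚ.≡ᵇ⇒≡ a k (subst T (sym a≡k) tt) | ℕₚ.≡ᵇ⇒≡ b k (subst T (sym b≡k) tt) = lem (k <ᵇ k) (x k)
  where
  lem : ∀ l y → ((l ∧ y) ∨ (l ∧ y)) ∨ y ≡ y ∨ y
  lem false false = refl
  lem false true = refl
  lem true false = refl
  lem true true = refl

foldR-notCol : ∀ a x k → foldR (notCol a) x k 0 false ≡ (a <ᵇ k) ∧ not (x a)
foldR-notCol a x zero = refl
foldR-notCol a x (suc k) rewrite foldR-suc (notCol a) x k false | foldR-notCol a x k | <ᵇ-suc a k with a ≡ᵇ k in a≡k
... | false = refl
... | true rewrite ℕₚ.≡ᵇ⇒≡ a k (subst T (sym a≡k) tt) | <ᵇ-irrefl k = refl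

isT : Outcome → Bool
isT (terminated b) = b
isT _ = false

module Circuit (m : ℕ) where

  Circ : Set
  Circ = List Column

  -- The inputs are the wires below m; the gate on top of Γ drives wire m + length Γ.
  wires : Circ → ℕ
  wires Γ = m + length Γ

  Sat : Circ → (ℕ → Bool) → Set
  Sat [] x = ⊤
  Sat (g ∷ Γ) x = x (wires Γ) ≡ foldR g x (wires Γ) 0 false × Sat Γ x

  wires-∷ : ∀ g Γ → wires Γ < wires (g ∷ Γ)
  wires-∷ g Γ = ℕₚ.+-monoʳ-< m ℕₚ.≤-refl

  Sat-cong : ∀ Γ {x x'} → (∀ {j} → j < wires Γ → x j ≡ x' j) → Sat Γ x → Sat Γ x'
  Sat-cong [] h s = tt
  Sat-cong (g ∷ Γ) {x} {x'} h (e , s) =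
    trans (sym (h (wires-∷ g Γ))) (trans e (foldR-cong (wires Γ) false (λ lt → refl , h' lt))) , Sat-cong Γ h' s
    where
    h' : ∀ {j} → j < wires Γ → x j ≡ x' j
    h' lt = h (ℕₚ.<-trans lt (wires-∷ g Γ))

  -- A gate reads only wires below its own, so the gates can be evaluated in the order of their
  -- creation.
  Sat-exists : ∀ Γ (x₀ : ℕ → Bool) → Σ (ℕ → Bool) λ x → (∀ {j} → j < m → x j ≡ x₀ j) × Sat Γ x
  Sat-exists [] x₀ = x₀ , (λ _ → refl) , tt
  Sat-exists (g ∷ Γ) x₀ with Sat-exists Γ x₀
  ... | x , h , s = x' , (λ lt → trans (sym (below (ℕₚ.<-≤-trans lt (ℕₚ.m≤m+n m _)))) (h lt)) ,
      trans at (foldR-cong (wires Γ) false (λ lt → refl , below lt)) , Sat-cong Γ below s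
    where
    x' : ℕ → Bool
    x' j with j ≟ wires Γ
    ... | yes _ = foldR g x (wires Γ) 0 false
    ... | no _ = x j
    below : ∀ {j} → j < wires Γ → x j ≡ x' j
    below {j} lt with j ≟ wires Γ
    ... | yes e = ⊥-elim (ℕₚ.<⇒≢ lt e)
    ... | no _ = refl
    at : x' (wires Γ) ≡ foldR g x (wires Γ) 0 false
    at with wires Γ ≟ wires Γ
    ... | yes _ = refl
    ... | no ne = ⊥-elim (ne refl)

  inputs : (ℕ → Bool) → Vec Bool m
  inputs x = tabulate (λ i → x (toℕ i))

  -- Gate bits are guessed by the machine, so `correct` has to hold under every assignment that
  -- passes the checks.
  record Wire (Γ : Circ) (φ : Vec Bool m → Bool) : Set where
    constructor wire
    field
      idx : ℕ
      bound : idx < wires Γ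
      correct : ∀ x → Sat Γ x → x idx ≡ φ (inputs x)

  Sat-⊑ : ∀ {Γ Γ' x} → Γ ⊑ Γ' → Sat Γ' x → Sat Γ x
  Sat-⊑ ⊑-refl s = s
  Sat-⊑ (⊑-cons e) (_ , s) = Sat-⊑ e s

  lift : ∀ {Γ Γ' φ} → Γ ⊑ Γ' → Wire Γ φ → Wire Γ' φ
  lift e (wire i b c) = wire i (ℕₚ.<-≤-trans b (ℕₚ.+-monoʳ-≤ m (⊑-length e))) (λ x s → c x (Sat-⊑ e s))

  recast : ∀ {Γ φ ψ} → (∀ v → φ v ≡ ψ v) → Wire Γ φ → Wire Γ ψ
  recast h (wire i b c) = wire i b (λ x s → trans (c x s) (h (inputs x)))

  gate : ∀ {Γ φ} g → (∀ x → Sat Γ x → foldR g x (wires Γ) 0 false ≡ φ (inputs x)) → Build 1 Γ (λ Γ' → Wire Γ' φ)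
  gate {Γ} g h = built (⊑-cons {y = g} ⊑-refl) ℕₚ.≤-refl (wire (wires Γ) (wires-∷ g Γ) (λ x (e , s) → trans e (h x s)))

  orW : ∀ {Γ φ ψ} → Wire Γ φ → Wire Γ ψ → Build 1 Γ (λ Γ' → Wire Γ' (λ v → φ v ∨ ψ v))
  orW {Γ} (wire i i< ci) (wire j j< cj) = gate (orCol i j) λ x s → trans (foldR-orCol i j x (wires Γ))
    (cong₂ _∨_ (cong₂ _∧_ (<⇒<ᵇ-true i<) (ci x s)) (cong₂ _∧_ (<⇒<ᵇ-true j<) (cj x s)))

  notW : ∀ {Γ φ} → Wire Γ φ → Build 1 Γ (λ Γ' → Wire Γ' (λ v → not (φ v)))
  notW {Γ} (wire i i< ci) = gate (notCol i) λ x s → trans (foldR-notCol i x (wires Γ))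
    (cong₂ _∧_ (<⇒<ᵇ-true i<) (cong not (ci x s)))

  constW : ∀ {Γ} b → Build 2 Γ (λ Γ' → Wire Γ' (λ _ → b))
  constW {Γ} false = weaken (s≤s z≤n) (gate {Γ} (λ _ → none) (λ x s → foldR-none x (wires Γ) false))
  constW {Γ} true = gate {Γ} (λ _ → none) (λ x s → foldR-none x (wires Γ) false) >>= λ _ w → notW w

  andW : ∀ {Γ φ ψ} → Wire Γ φ → Wire Γ ψ → Build 4 Γ (λ Γ' → Wire Γ' (λ v → φ v ∧ ψ v))
  andW {Γ} {φ} {ψ} a b = notW a >>= λ e a' → notW (lift e b) >>= λ e' b' → orW (lift e' a') b' >>= λ _ c →
    map-result (recast (λ v → lem (φ v) (ψ v))) (notW c)
    where
    lem : ∀ p q → not (not p ∨ not q) ≡ p ∧ q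
    lem false q = refl
    lem true q = Boolₚ.not-involutive q

  muxW : ∀ {Γ φ ψ χ} → Wire Γ φ → Wire Γ ψ → Wire Γ χ → Build 10 Γ (λ Γ' → Wire Γ' (λ v → if φ v then ψ v else χ v))
  muxW {Γ} {φ} {ψ} {χ} c a b = andW c a >>= λ e t → notW (lift e c) >>= λ e' c' → andW c' (lift (⊑-trans e e') b) >>= λ e'' f →
    map-result (recast (λ v → lem (φ v) (ψ v) (χ v))) (orW (lift (⊑-trans e' e'') t) f)
    where
    lem : ∀ p q r → (p ∧ q) ∨ (not p ∧ r) ≡ (if p then q else r)
    lem false q r = refl
    lem true q r = Boolₚ.∨-identityʳ q

  inputW : ∀ {Γ k} (lt : k < m) → Wire Γ (λ v → lookup v (fromℕ< lt))
  inputW {Γ} {k} lt = wire k (ℕₚ.<-≤-trans lt (ℕₚ.m≤m+n m _)) λ x s →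
    sym (trans (Vecₚ.lookup∘tabulate (λ i → x (toℕ i)) (fromℕ< lt)) (cong x (Finₚ.toℕ-fromℕ< lt)))

-- Symbolic execution of instruction sequences

-- `pend` counts the instructions still to be skipped and is `nothing` once execution has ended;
-- `res` takes the content of `out` when `halt` is executed. Active or not, every instruction
-- transforms the snapshot once, which gives a circuit of fixed shape.
record Snapshot : Set where
  constructor snapshot
  field
    pend : Maybe ℕ
    aux  : Aux
    out  : Bool
    res  : Bool

onActive : (Aux → Bool → Bool → Snapshot) → Snapshot → Snapshot
onActive F (snapshot (just zero) a o r) = F a o r
onActive F (snapshot (just (suc d)) a o r) = snapshot (just d) a o r
onActive F (snapshot nothing a o r) = snapshot nothing a o r

after : (Bool → Bool) → Maybe (Aux × Bool × Bool) → Aux → Bool → Bool → Snapshot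
after f nothing a o r = snapshot nothing a o r
after f (just (a' , o' , b)) _ _ r = snapshot (just (if f b then 0 else 1)) a' o' r

exec : ∀ {m} → Vec Bool m → Prim → Aux → Bool → Bool → Snapshot
exec v (plain b) a o r = after (λ _ → true) (doBasic v b a o) a o r
exec v (ptest b) a o r = after id (doBasic v b a o) a o r
exec v (ntest b) a o r = after not (doBasic v b a o) a o r
exec v (jump zero) a o r = snapshot nothing a o r
exec v (jump (suc l)) a o r = snapshot (just l) a o r
exec v halt a o r = snapshot nothing a o o

runSnapshot : ∀ {m} → Vec Bool m → InstrSeq → Snapshot → Snapshot
runSnapshot v [] s = s
runSnapshot v (u ∷ X) s = runSnapshot v X (onActive (exec v u) s)

runSnapshot-nothing : ∀ {m} (v : Vec Bool m) X a o r → Snapshot.res (runSnapshot v X (snapshot nothing a o r)) ≡ r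
runSnapshot-nothing v [] a o r = refl
runSnapshot-nothing v (u ∷ X) a o r = runSnapshot-nothing v X a o r

runSnapshot-scan : ∀ {m} (v : Vec Bool m) X d a o → Snapshot.res (runSnapshot v X (snapshot (just d) a o false)) ≡ isT (scan v X d a o)
runSnapshot-scan v [] d a o = refl
runSnapshot-scan v (u ∷ X) (suc d) a o = runSnapshot-scan v X d a o
runSnapshot-scan v (plain b ∷ X) zero a o with doBasic v b a o
... | nothing = runSnapshot-nothing v X a o false
... | just (a' , o' , _) = runSnapshot-scan v X 0 a' o'
runSnapshot-scan v (ptest b ∷ X) zero a o with doBasic v b a o
... | nothing = runSnapshot-nothing v X a o false
... | just (a' , o' , true) = runSnapshot-scan v X 0 a' o'
... | just (a' , o' , false) = runSnapshot-scan v X 1 a' o'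
runSnapshot-scan v (ntest b ∷ X) zero a o with doBasic v b a o
... | nothing = runSnapshot-nothing v X a o false
... | just (a' , o' , true) = runSnapshot-scan v X 1 a' o'
... | just (a' , o' , false) = runSnapshot-scan v X 0 a' o'
runSnapshot-scan v (jump zero ∷ X) zero a o = runSnapshot-nothing v X a o false
runSnapshot-scan v (jump (suc l) ∷ X) zero a o = runSnapshot-scan v X l a o
runSnapshot-scan v (halt ∷ X) zero a o = runSnapshot-nothing v X a o o

isAt : ℕ → Maybe ℕ → Bool
isAt d nothing = false
isAt d (just d') = d ≡ᵇ d'

≡ᵇ-refl : ∀ n → (n ≡ᵇ n) ≡ true
≡ᵇ-refl zero = refl
≡ᵇ-refl (suc n) = ≡ᵇ-refl n

≢⇒≡ᵇ-false : ∀ {m n} → m ≢ n → (m ≡ᵇ n) ≡ false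
≢⇒≡ᵇ-false {m} {n} ne with m ≡ᵇ n in eq
... | false = refl
... | true = ⊥-elim (ne (ℕₚ.≡ᵇ⇒≡ m n (subst T (sym eq) tt)))

doBasic-inGet : ∀ {m} (v : Vec Bool m) {k} (lt : k < m) a o → doBasic v (inGet k) a o ≡ just (a , o , lookup v (fromℕ< lt))
doBasic-inGet {m} v {k} lt a o with k <? m
... | yes lt' = cong (λ p → just (a , o , lookup v (fromℕ< p))) (ℕₚ.<-irrelevant lt' lt)
... | no ¬lt = ⊥-elim (¬lt lt)

doBasic-badInput : ∀ {m} (v : Vec Bool m) {k} → ¬ k < m → ∀ a o → doBasic v (inGet k) a o ≡ nothing
doBasic-badInput {m} v {k} ¬lt a o with k <? m
... | yes lt = ⊥-elim (¬lt lt)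
... | no _ = refl

module Symbolic (m : ℕ) where
  open Circuit m

  active : Snapshot → Bool
  active s = isAt 0 (Snapshot.pend s)

  -- `pend` is kept in unary, one wire per distance. Infinitely many quantities need only finitely
  -- many gates: wires may be shared, counting down merely renames the distances, and a step changes
  -- a bounded number of quantities.
  record Tracked (Γ : Circ) (S : Vec Bool m → Snapshot) : Set where
    constructor symb
    field
      pendW : ∀ d → Wire Γ (λ v → isAt d (Snapshot.pend (S v)))
      auxW  : ∀ k → Wire Γ (λ v → Snapshot.aux (S v) k)
      outW  : Wire Γ (λ v → Snapshot.out (S v))
      resW  : Wire Γ (λ v → Snapshot.res (S v))
  open Tracked

  liftS : ∀ {Γ Γ' S} → Γ ⊑ Γ' → Tracked Γ S → Tracked Γ' S
  liftS e (symb p a o r) = symb (λ d → lift e (p d)) (λ k → lift e (a k)) (lift e o) (lift e r)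

  -- An active snapshot has no positive distance pending, so the renaming that counts down already
  -- yields the stopped state, without a gate.
  kill : ∀ {Γ S} {F : Vec Bool m → Aux → Bool → Bool → Snapshot} → (∀ v a o r → F v a o r ≡ snapshot nothing a o r) → Tracked Γ S → Tracked Γ (λ v → onActive (F v) (S v))
  kill {Γ} {S} {F} h (symb p a o r) = symb
    (λ d → recast (λ v → lemP d v (S v)) (p (suc d)))
    (λ k → recast (λ v → lemA k v (S v)) (a k))
    (recast (λ v → lemO v (S v)) o)
    (recast (λ v → lemR v (S v)) r)
    where
    lemP : ∀ d v s → isAt (suc d) (Snapshot.pend s) ≡ isAt d (Snapshot.pend (onActive (F v) s))
    lemP d v (snapshot (just zero) a o r) rewrite h v a o r = refl
    lemP d v (snapshot (just (suc _)) a o r) = refl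
    lemP d v (snapshot nothing a o r) = refl
    lemA : ∀ k v s → Snapshot.aux s k ≡ Snapshot.aux (onActive (F v) s) k
    lemA k v (snapshot (just zero) a o r) rewrite h v a o r = refl
    lemA k v (snapshot (just (suc _)) a o r) = refl
    lemA k v (snapshot nothing a o r) = refl
    lemO : ∀ v s → Snapshot.out s ≡ Snapshot.out (onActive (F v) s)
    lemO v (snapshot (just zero) a o r) rewrite h v a o r = refl
    lemO v (snapshot (just (suc _)) a o r) = refl
    lemO v (snapshot nothing a o r) = refl
    lemR : ∀ v s → Snapshot.res s ≡ Snapshot.res (onActive (F v) s)
    lemR v (snapshot (just zero) a o r) rewrite h v a o r = refl
    lemR v (snapshot (just (suc _)) a o r) = refl
    lemR v (snapshot nothing a o r) = refl

  -- Only distance l acquires a second source: the jump joins whatever was already due there.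
  symJump : ∀ {Γ S} l → Tracked Γ S → Build 1 Γ (λ Γ' → Tracked Γ' (λ v → onActive (exec v (jump (suc l))) (S v)))
  symJump {Γ} {S} l s = orW (pendW s 0) (pendW s (suc l)) >>= λ e w →
    return (symb (p e w)
      (λ k → recast (λ v → lemA k (S v)) (lift e (auxW s k)))
      (recast (λ v → lemO (S v)) (lift e (outW s)))
      (recast (λ v → lemR (S v)) (lift e (resW s))))
    where
    F : Aux → Bool → Bool → Snapshot
    F a o r = snapshot (just l) a o r
    lemA : ∀ k s → Snapshot.aux s k ≡ Snapshot.aux (onActive F s) k
    lemA k (snapshot (just zero) a o r) = refl
    lemA k (snapshot (just (suc _)) a o r) = refl
    lemA k (snapshot nothing a o r) = refl
    lemO : ∀ s → Snapshot.out s ≡ Snapshot.out (onActive F s)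
    lemO (snapshot (just zero) a o r) = refl
    lemO (snapshot (just (suc _)) a o r) = refl
    lemO (snapshot nothing a o r) = refl
    lemR : ∀ s → Snapshot.res s ≡ Snapshot.res (onActive F s)
    lemR (snapshot (just zero) a o r) = refl
    lemR (snapshot (just (suc _)) a o r) = refl
    lemR (snapshot nothing a o r) = refl
    lemP : ∀ s → active s ∨ isAt (suc l) (Snapshot.pend s) ≡ isAt l (Snapshot.pend (onActive F s))
    lemP (snapshot (just zero) a o r) = sym (≡ᵇ-refl l)
    lemP (snapshot (just (suc _)) a o r) = refl
    lemP (snapshot nothing a o r) = refl
    lemP' : ∀ d → d ≢ l → ∀ s → isAt (suc d) (Snapshot.pend s) ≡ isAt d (Snapshot.pend (onActive F s))
    lemP' d ne (snapshot (just zero) a o r) = sym (≢⇒≡ᵇ-false ne)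
    lemP' d ne (snapshot (just (suc _)) a o r) = refl
    lemP' d ne (snapshot nothing a o r) = refl
    p : ∀ {Γ'} → Γ ⊑ Γ' → Wire Γ' (λ v → active (S v) ∨ isAt (suc l) (Snapshot.pend (S v))) →
        ∀ d → Wire Γ' (λ v → isAt d (Snapshot.pend (onActive F (S v))))
    p e w d with d ≟ l
    ... | yes refl = recast (λ v → lemP (S v)) w
    ... | no ne = recast (λ v → lemP' d ne (S v)) (lift e (pendW s (suc d)))

  symHalt : ∀ {Γ S} → Tracked Γ S → Build 10 Γ (λ Γ' → Tracked Γ' (λ v → onActive (exec v halt) (S v)))
  symHalt {Γ} {S} s = muxW (pendW s 0) (outW s) (resW s) >>= λ e w →
    return (symb
      (λ d → recast (λ v → lemP d (S v)) (lift e (pendW s (suc d))))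
      (λ k → recast (λ v → lemA k (S v)) (lift e (auxW s k)))
      (recast (λ v → lemO (S v)) (lift e (outW s)))
      (recast (λ v → lemR (S v)) w))
    where
    F : Aux → Bool → Bool → Snapshot
    F a o r = snapshot nothing a o o
    lemP : ∀ d s → isAt (suc d) (Snapshot.pend s) ≡ isAt d (Snapshot.pend (onActive F s))
    lemP d (snapshot (just zero) a o r) = refl
    lemP d (snapshot (just (suc _)) a o r) = refl
    lemP d (snapshot nothing a o r) = refl
    lemA : ∀ k s → Snapshot.aux s k ≡ Snapshot.aux (onActive F s) k
    lemA k (snapshot (just zero) a o r) = refl
    lemA k (snapshot (just (suc _)) a o r) = refl
    lemA k (snapshot nothing a o r) = refl
    lemO : ∀ s → Snapshot.out s ≡ Snapshot.out (onActive F s)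
    lemO (snapshot (just zero) a o r) = refl
    lemO (snapshot (just (suc _)) a o r) = refl
    lemO (snapshot nothing a o r) = refl
    lemR : ∀ s → (if active s then Snapshot.out s else Snapshot.res s) ≡ Snapshot.res (onActive F s)
    lemR (snapshot (just zero) a o r) = refl
    lemR (snapshot (just (suc _)) a o r) = refl
    lemR (snapshot nothing a o r) = refl

  testF : (f : Bool → Bool) → Basic → Vec Bool m → Aux → Bool → Bool → Snapshot
  testF f b v a o r = after f (doBasic v b a o) a o r

  -- f maps the reply to whether the next instruction is executed rather than skipped.
  symTest : ∀ {Γ S} (f : Bool → Bool) b {A : Aux → Aux} {O : Bool → Bool} {R : Vec Bool m → Aux → Bool} →
    (∀ v a o → doBasic v b a o ≡ just (A a , O o , R v a)) →
    Tracked Γ S →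
    Wire Γ (λ v → f (R v (Snapshot.aux (S v)))) →
    (∀ k → Wire Γ (λ v → if active (S v) then A (Snapshot.aux (S v)) k else Snapshot.aux (S v) k)) →
    Wire Γ (λ v → if active (S v) then O (Snapshot.out (S v)) else Snapshot.out (S v)) →
    Build 11 Γ (λ Γ' → Tracked Γ' (λ v → onActive (testF f b v) (S v)))
  symTest {Γ} {S} f b {A} {O} {R} D s ρ aw ow =
    andW (pendW s 0) ρ >>= λ e₁ t → orW t (lift e₁ (pendW s 1)) >>= λ e₂ w₀ →
    notW (lift (⊑-trans e₁ e₂) ρ) >>= λ e₃ nρ → andW (lift (⊑-trans e₁ (⊑-trans e₂ e₃)) (pendW s 0)) nρ >>= λ e₄ u →
    orW u (lift (⊑-trans e₁ (⊑-trans e₂ (⊑-trans e₃ e₄))) (pendW s 2)) >>= λ e₅ w₁ →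
    let e = ⊑-trans e₁ (⊑-trans e₂ (⊑-trans e₃ (⊑-trans e₄ e₅))) in
    return (symb (p e (lift (⊑-trans e₃ (⊑-trans e₄ e₅)) w₀) w₁)
      (λ k → recast (λ v → lemA k v (S v)) (lift e (aw k)))
      (recast (λ v → lemO v (S v)) (lift e ow))
      (recast (λ v → lemR v (S v)) (lift e (resW s))))
    where
    F : Vec Bool m → Aux → Bool → Bool → Snapshot
    F = testF f b
    lemA : ∀ k v s → (if active s then A (Snapshot.aux s) k else Snapshot.aux s k) ≡ Snapshot.aux (onActive (F v) s) k
    lemA k v (snapshot (just zero) a o r) rewrite D v a o = refl
    lemA k v (snapshot (just (suc _)) a o r) = refl
    lemA k v (snapshot nothing a o r) = refl
    lemO : ∀ v s → (if active s then O (Snapshot.out s) else Snapshot.out s) ≡ Snapshot.out (onActive (F v) s)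
    lemO v (snapshot (just zero) a o r) rewrite D v a o = refl
    lemO v (snapshot (just (suc _)) a o r) = refl
    lemO v (snapshot nothing a o r) = refl
    lemR : ∀ v s → Snapshot.res s ≡ Snapshot.res (onActive (F v) s)
    lemR v (snapshot (just zero) a o r) rewrite D v a o = refl
    lemR v (snapshot (just (suc _)) a o r) = refl
    lemR v (snapshot nothing a o r) = refl
    lem₀ : ∀ v s → (active s ∧ f (R v (Snapshot.aux s))) ∨ isAt 1 (Snapshot.pend s) ≡ isAt 0 (Snapshot.pend (onActive (F v) s))
    lem₀ v (snapshot (just zero) a o r) rewrite D v a o with f (R v a)
    ... | true = refl
    ... | false = refl
    lem₀ v (snapshot (just (suc _)) a o r) = refl
    lem₀ v (snapshot nothing a o r) = refl
    lem₁ : ∀ v s → (active s ∧ not (f (R v (Snapshot.aux s)))) ∨ isAt 2 (Snapshot.pend s) ≡ isAt 1 (Snapshot.pend (onActive (F v) s))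
    lem₁ v (snapshot (just zero) a o r) rewrite D v a o with f (R v a)
    ... | true = refl
    ... | false = refl
    lem₁ v (snapshot (just (suc _)) a o r) = refl
    lem₁ v (snapshot nothing a o r) = refl
    lem₂ : ∀ d v s → isAt (suc (suc (suc d))) (Snapshot.pend s) ≡ isAt (suc (suc d)) (Snapshot.pend (onActive (F v) s))
    lem₂ d v (snapshot (just zero) a o r) rewrite D v a o with f (R v a)
    ... | true = refl
    ... | false = refl
    lem₂ d v (snapshot (just (suc _)) a o r) = refl
    lem₂ d v (snapshot nothing a o r) = refl
    p : ∀ {Γ'} → Γ ⊑ Γ' → Wire Γ' (λ v → (active (S v) ∧ f (R v (Snapshot.aux (S v)))) ∨ isAt 1 (Snapshot.pend (S v))) →
        Wire Γ' (λ v → (active (S v) ∧ not (f (R v (Snapshot.aux (S v))))) ∨ isAt 2 (Snapshot.pend (S v))) →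
        ∀ d → Wire Γ' (λ v → isAt d (Snapshot.pend (onActive (F v) (S v))))
    p e w₀ w₁ zero = recast (λ v → lem₀ v (S v)) w₀
    p e w₀ w₁ (suc zero) = recast (λ v → lem₁ v (S v)) w₁
    p e w₀ w₁ (suc (suc d)) = recast (λ v → lem₂ d v (S v)) (lift e (pendW s (3 + d)))

  if-same : ∀ b (x : Bool) → x ≡ (if b then x else x)
  if-same false x = refl
  if-same true x = refl

  WireMap : (Bool → Bool) → Set
  WireMap f = ∀ {Γ φ} → Wire Γ φ → Build 2 Γ (λ Γ' → Wire Γ' (λ v → f (φ v)))

  -- The worst case is a set instruction: 2 gates for the constant, 2 for f, 10 for the new content
  -- and 11 for the branching.
  symBasic : ∀ {Γ S} {f : Bool → Bool} → WireMap f → ∀ b → Tracked Γ S →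
    Build 25 Γ (λ Γ' → Tracked Γ' (λ v → onActive (testF f b v) (S v)))
  symBasic {Γ} {S} {f} nf (inGet k) s = byRange (k <? m)
    where
    byRange : Dec (k < m) → Build 25 Γ (λ Γ' → Tracked Γ' (λ v → onActive (testF f (inGet k) v) (S v)))
    byRange (no ¬lt) = weaken z≤n (return (kill {F = testF f (inGet k)} h s))
      where
      h : ∀ v a o r → testF f (inGet k) v a o r ≡ snapshot nothing a o r
      h v a o r rewrite doBasic-badInput v ¬lt a o = refl
    byRange (yes lt) = weaken (ℕₚ.m≤m+n 13 12) (nf (inputW {Γ} lt) >>= λ e ρ →
      symTest f (inGet k) (λ v a o → doBasic-inGet v lt a o) (liftS e s) ρ
        (λ k → recast (λ v → if-same (active (S v)) _) (lift e (auxW s k)))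
        (recast (λ v → if-same (active (S v)) _) (lift e (outW s))))
  symBasic {Γ} {S} {f} nf (auxGet k) s = weaken (ℕₚ.m≤m+n 13 12) (nf (auxW s k) >>= λ e ρ →
    symTest f (auxGet k) {A = id} {O = id} {R = λ v a → a k} (λ v a o → refl) (liftS e s) ρ
      (λ k → recast (λ v → if-same (active (S v)) _) (lift e (auxW s k)))
      (recast (λ v → if-same (active (S v)) _) (lift e (outW s))))
  symBasic {Γ} {S} {f} nf (auxSet k b) s = constW b >>= λ e w → nf w >>= λ e' ρ →
    muxW (lift (⊑-trans e e') (pendW s 0)) (lift e' w) (lift (⊑-trans e e') (auxW s k)) >>= λ e'' new →
    let e+ = ⊑-trans e (⊑-trans e' e'') in
    symTest f (auxSet k b) {A = λ a j → if j ≡ᵇ k then b else a j} {O = id} {R = λ v a → b} (λ v a o → refl) (liftS e+ s) (lift e'' ρ)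
      (updated e+ new)
      (recast (λ v → if-same (active (S v)) _) (lift e+ (outW s)))
    where
    updated : ∀ {Γ'} → Γ ⊑ Γ' → Wire Γ' (λ v → if active (S v) then b else Snapshot.aux (S v) k) →
      ∀ j → Wire Γ' (λ v → if active (S v) then (if j ≡ᵇ k then b else Snapshot.aux (S v) j) else Snapshot.aux (S v) j)
    updated e+ new j with j ≟ k
    ... | yes refl rewrite ≡ᵇ-refl j = new
    ... | no ne rewrite ≢⇒≡ᵇ-false ne = recast (λ v → if-same (active (S v)) _) (lift e+ (auxW s j))
  symBasic {Γ} {S} {f} nf (outSet b) s = constW b >>= λ e w → nf w >>= λ e' ρ →
    muxW (lift (⊑-trans e e') (pendW s 0)) (lift e' w) (lift (⊑-trans e e') (outW s)) >>= λ e'' new →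
    let e+ = ⊑-trans e (⊑-trans e' e'') in
    symTest f (outSet b) {A = id} {O = λ _ → b} {R = λ v a → b} (λ v a o → refl) (liftS e+ s) (lift e'' ρ)
      (λ k → recast (λ v → if-same (active (S v)) _) (lift e+ (auxW s k)))
      new

  symStep : ∀ {Γ S} u → Tracked Γ S → Build 25 Γ (λ Γ' → Tracked Γ' (λ v → onActive (exec v u) (S v)))
  symStep (plain b) s = symBasic {f = λ _ → true} (λ _ → constW true) b s
  symStep (ptest b) s = symBasic {f = id} (λ w → weaken z≤n (return w)) b s
  symStep (ntest b) s = symBasic {f = not} (λ w → weaken (s≤s z≤n) (notW w)) b s
  symStep (jump zero) s = weaken z≤n (return (kill {F = λ v a o r → snapshot nothing a o r} (λ v a o r → refl) s))
  symStep (jump (suc l)) s = weaken (s≤s z≤n) (symJump l s)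
  symStep halt s = weaken (ℕₚ.m≤m+n 10 15) (symHalt s)

  symRun : ∀ {Γ S} X → Tracked Γ S → Build (length X * 25) Γ (λ Γ' → Tracked Γ' (λ v → runSnapshot v X (S v)))
  symRun [] s = return s
  symRun (u ∷ X) s = symStep u s >>= λ _ s' → symRun X s'

  symInit : Build 4 [] (λ Γ → Tracked Γ (λ v → snapshot (just 0) (λ _ → false) false false))
  symInit = constW false >>= λ e f → constW true >>= λ e' t →
    return (symb (λ { zero → t ; (suc d) → lift e' f }) (λ k → lift e' f) (lift e' f) (lift e' f))

  compile : ∀ X → Build (4 + length X * 25) [] (λ Γ → Wire Γ (λ v → isT (scan v X 0 (λ _ → false) false)))
  compile X = symInit >>= λ _ s → map-result (λ s' → recast (λ v → runSnapshot-scan v X 0 (λ _ → false) false) (resW s')) (symRun X s)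

-- NP-IS is contained in NP/poly

Agree : ∀ {n} → Vec Bool n → ℕ → (ℕ → Bool) → Set
Agree [] i x = ⊤
Agree (b ∷ w) i x = x i ≡ b × Agree w (suc i) x

-- Column i starts from the i-th input bit, and its only cell compares that bit with wire i.
inputCols : ℕ → ℕ → List Column
inputCols zero i = []
inputCols (suc k) i = truncate (λ _ → none) Q i ∷ inputCols k (suc i)

length-inputCols : ∀ k i → length (inputCols k i) ≡ k
length-inputCols zero i = refl
length-inputCols (suc k) i = cong suc (length-inputCols k (suc i))

op-Q-true : ∀ {x s} → op Q x s ≡ true → x ≡ s
op-Q-true {false} {false} _ = refl
op-Q-true {true} {true} _ = refl

op-Q-refl : ∀ s → op Q s s ≡ true
op-Q-refl false = refl
op-Q-refl true = refl

foldR-single : ∀ c k x G s → k < G → foldR (truncate (λ _ → none) c k) x G 0 s ≡ op c (x k) s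
foldR-single c k x G s k<G = trans (foldR-truncate (λ _ → none) c k x G s k<G) (cong (op c (x k)) (foldR-none x k s))

AllSat-inputs : ∀ {n} (w : Vec Bool n) i rest x G → i + n ≤ G →
  AllSat (toList w) (inputCols n i ++ rest) x G ⇔ (Agree w i x × AllSat [] rest x G)
AllSat-inputs [] i rest x G le = mk⇔ (tt ,_) proj₂
AllSat-inputs {suc n} (b ∷ w) i rest x G le = mk⇔
  (λ (s , s′) → let a , r = to ih s′ in (op-Q-true (trans (sym eq) s) , a) , r)
  (λ ((e , a) , r) → trans eq (trans (cong (λ z → op Q z b) e) (op-Q-refl b)) , from ih (a , r))
  where
  le' : suc i + n ≤ G
  le' = subst (_≤ G) (ℕₚ.+-suc i n) le
  eq : foldR (truncate (λ _ → none) Q i) x G 0 b ≡ op Q (x i) b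
  eq = foldR-single Q i x G b (ℕₚ.≤-trans (ℕₚ.m≤m+n (suc i) n) le')
  ih : AllSat (toList w) (inputCols n (suc i) ++ rest) x G ⇔ (Agree w (suc i) x × AllSat [] rest x G)
  ih = AllSat-inputs w (suc i) rest x G le'

agree-tabulate : ∀ {n} h (w : Vec Bool n) i x → Agree w i x →
  tabulate {n = n + h} (λ j → x (i + toℕ j)) ≡ w ++ᵥ tabulate {n = h} (λ j → x (i + (n + toℕ j)))
agree-tabulate h [] i x _ = refl
agree-tabulate {suc n} h (b ∷ w) i x (e , a) = cong₂ _∷_ (trans (cong x (ℕₚ.+-identityʳ i)) e)
  (trans (Vecₚ.tabulate-cong (λ j → cong x (ℕₚ.+-suc i (toℕ j))))
    (trans (agree-tabulate h w (suc i) x a) (cong (w ++ᵥ_) (Vecₚ.tabulate-cong (λ j → cong x (sym (ℕₚ.+-suc i (n + toℕ j))))))))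

nth : ∀ {n} → Vec Bool n → ℕ → Bool
nth [] i = false
nth (b ∷ v) zero = b
nth (b ∷ v) (suc i) = nth v i

tabulate-nth : ∀ {n} (v : Vec Bool n) → tabulate (λ j → nth v (toℕ j)) ≡ v
tabulate-nth [] = refl
tabulate-nth (b ∷ v) = cong (b ∷_) (tabulate-nth v)

agree-nth : ∀ {n h} (w : Vec Bool n) (c : Vec Bool h) i x → (∀ {t} → t < n → x (i + t) ≡ nth (w ++ᵥ c) t) → Agree w i x
agree-nth [] c i x eq = tt
agree-nth (b ∷ w) c i x eq = trans (cong x (sym (ℕₚ.+-identityʳ i))) (eq (s≤s z≤n)) ,
  agree-nth w c (suc i) x (λ {t} lt → trans (cong x (sym (ℕₚ.+-suc i t))) (eq (s≤s lt)))

module _ (m : ℕ) where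
  open Circuit m

  gateCols : Circ → List Column
  gateCols [] = []
  gateCols (g ∷ Γ) = truncate g Q (wires Γ) ∷ gateCols Γ

  length-gateCols : ∀ Γ → length (gateCols Γ) ≡ length Γ
  length-gateCols [] = refl
  length-gateCols (g ∷ Γ) = cong suc (length-gateCols Γ)

  AllSat-gates : ∀ Γ rest x G → wires Γ ≤ G → AllSat [] (gateCols Γ ++ rest) x G ⇔ (Sat Γ x × AllSat [] rest x G)
  AllSat-gates [] rest x G le = mk⇔ (tt ,_) proj₂
  AllSat-gates (g ∷ Γ) rest x G le = mk⇔
    (λ (s , s′) → let a , r = to ih s′ in (op-Q-true (trans (sym eq) s) , a) , r)
    (λ ((e , a) , r) → trans eq (trans (cong (λ z → op Q z v) e) (op-Q-refl v)) , from ih (a , r))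
    where
    lt : wires Γ < G
    lt = ℕₚ.<-≤-trans (wires-∷ g Γ) le
    v : Bool
    v = foldR g x (wires Γ) 0 false
    eq : foldR (truncate g Q (wires Γ)) x G 0 false ≡ op Q (x (wires Γ)) v
    eq = foldR-truncate g Q (wires Γ) x G false lt
    ih : AllSat [] (gateCols Γ ++ rest) x G ⇔ (Sat Γ x × AllSat [] rest x G)
    ih = AllSat-gates Γ rest x G (ℕₚ.<⇒≤ lt)

module Matrix {n h : ℕ} {Γ : List Column} {φ : Vec Bool (n + h) → Bool} (out : Circuit.Wire (n + h) Γ φ) where
  open Circuit (n + h)
  open Wire out

  -- The lone `P` of the last column, met with the flag still false, demands that the output wire be
  -- true.
  cols : List Column
  cols = inputCols n 0 ++ (gateCols (n + h) Γ ++ truncate (λ _ → none) P idx ∷ [])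

  length-cols : length cols ≡ n + (length Γ + 1)
  length-cols = trans (Listₚ.length-++ (inputCols n 0))
    (cong₂ _+_ (length-inputCols n 0) (trans (Listₚ.length-++ (gateCols (n + h) Γ)) (cong (_+ 1) (length-gateCols (n + h) Γ))))

  AllSat-cols : ∀ w → (∃ λ x → AllSat (toList w) cols x (wires Γ)) ⇔ (∃ λ c → φ (w ++ᵥ c) ≡ true)
  AllSat-cols w = mk⇔ fw bw
    where
    G : ℕ
    G = wires Γ
    n≤G : n ≤ G
    n≤G = ℕₚ.≤-trans (ℕₚ.m≤m+n n h) (ℕₚ.m≤m+n (n + h) (length Γ))
    outEq : ∀ x → foldR (truncate (λ _ → none) P idx) x G 0 false ≡ x idx
    outEq x = foldR-single P idx x G false bound
    fw : (∃ λ x → AllSat (toList w) cols x G) → ∃ λ c → φ (w ++ᵥ c) ≡ true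
    fw (x , s) = let a , s₁ = to (AllSat-inputs w 0 _ x G n≤G) s
                     sat , o , _ = to (AllSat-gates (n + h) Γ _ x G ℕₚ.≤-refl) s₁ in
      -- The wires from n to n + h - 1 are inputs of the circuit without an input column; the bits
      -- guessed there are the certificate.
      tabulate (λ j → x (n + toℕ j)) ,
      trans (cong φ (sym (agree-tabulate h w 0 x a))) (trans (sym (correct x sat)) (trans (sym (outEq x)) o))
    bw : (∃ λ c → φ (w ++ᵥ c) ≡ true) → ∃ λ x → AllSat (toList w) cols x G
    bw (c , e) with Sat-exists Γ (nth (w ++ᵥ c))
    ... | x , low , sat = x , from (AllSat-inputs w 0 _ x G n≤G)
      (agree-nth w c 0 x (λ lt → low (ℕₚ.<-≤-trans lt (ℕₚ.m≤m+n n h))) ,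
       from (AllSat-gates (n + h) Γ _ x G ℕₚ.≤-refl) (sat , trans (outEq x) (trans (correct x sat) (trans (cong φ inp) e)) , tt))
      where
      inp : inputs x ≡ w ++ᵥ c
      inp = trans (Vecₚ.tabulate-cong (λ j → low (Data.Fin.Properties.toℕ<n j))) (tabulate-nth (w ++ᵥ c))
        where import Data.Fin.Properties

bool-ext : ∀ {a b : Bool} → (a ≡ true → b ≡ true) → (b ≡ true → a ≡ true) → a ≡ b
bool-ext {false} {false} f g = refl
bool-ext {false} {true} f g = g refl
bool-ext {true} {b} f g = sym (f refl)

does⇔ : ∀ {A : Set} (d : Dec A) → (does d ≡ true) ⇔ A
does⇔ (yes a) = mk⇔ (λ _ → a) (λ _ → refl)
does⇔ (no ¬a) = mk⇔ (λ ()) (λ a → ⊥-elim (¬a a))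

checker-decides : List Bool → Bool
checker-decides y = does (Acceptance.acc? checker (⟦ timeBound ⟧ (length y)) (initConfig checker y))

checker-decides-NP : NP checker-decides
checker-decides-NP = checker , ⟦ timeBound ⟧ , isPolynomial timeBound , λ y → does⇔ (Acceptance.acc? checker (⟦ timeBound ⟧ (length y)) (initConfig checker y))

NP-IS⇒NP/poly : ∀ f → NP-IS f → NP/poly (toLang f)
NP-IS⇒NP/poly f (h , ph , _ , g , (hg , phg , prog) , spec) =
  checker-decides , checker-decides-NP , adv , ⟦ size ⟧ , isPolynomial size , adv-size , adv-correct
  where
  X : ℕ → InstrSeq
  X n = proj₁ (prog (n + h n))

  circuit : ∀ n → Build (4 + length (X n) * 25) [] (λ Γ → Circuit.Wire (n + h n) Γ (λ v → isT (scan v (X n) 0 (λ _ → false) false)))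
  circuit n = Symbolic.compile (n + h n) (X n)

  Γ : ∀ n → List Column
  Γ n = Build.list (circuit n)

  module Mat (n : ℕ) = Matrix {n} {h n} (Build.result (circuit n))

  G : ℕ → ℕ
  G n = n + h n + length (Γ n)

  adv : ℕ → List Bool
  adv n = advice (Mat.cols n) (G n)

  eh eg em eΓ eG eC size : Poly
  eh = proj₁ (dominated {h} ph)
  eg = proj₁ (dominated {hg} phg)
  em = var ⊕ eh
  eΓ = con 4 ⊕ eg ⟪ em ⟫ ⊗ con 25
  eG = em ⊕ eΓ
  eC = con 1 ⊕ (var ⊕ (eΓ ⊕ con 1))
  -- Each of the rows has a marker and one cell per column, and each of these tokens takes two bits.
  size = eG ⊗ eC ⊕ eG ⊗ eC

  m≤em : ∀ n → n + h n ≤ ⟦ em ⟧ n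
  m≤em n = ℕₚ.+-monoʳ-≤ n (proj₂ (dominated {h} ph) n)

  X≤ : ∀ n → length (X n) ≤ ⟦ eg ⟪ em ⟫ ⟧ n
  X≤ n = begin
    length (X n)             ≤⟨ proj₁ (proj₂ (proj₂ (prog (n + h n)))) ⟩
    hg (n + h n)             ≤⟨ proj₂ (dominated {hg} phg) (n + h n) ⟩
    ⟦ eg ⟧ (n + h n)         ≤⟨ ⟦⟧-mono eg (m≤em n) ⟩
    ⟦ eg ⟧ (⟦ em ⟧ n)        ≡⟨ ⟪⟫-eval eg em n ⟨
    ⟦ eg ⟪ em ⟫ ⟧ n          ∎
    where open ℕₚ.≤-Reasoning

  Γ≤ : ∀ n → length (Γ n) ≤ ⟦ eΓ ⟧ n
  Γ≤ n = ℕₚ.≤-trans (Build.size (circuit n)) (ℕₚ.≤-trans (ℕₚ.≤-reflexive (ℕₚ.+-identityʳ _))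
    (ℕₚ.+-monoʳ-≤ 4 (ℕₚ.*-monoˡ-≤ 25 (X≤ n))))

  adv-size : ∀ n → length (adv n) ≤ ⟦ size ⟧ n
  adv-size n = begin
    length (adv n)   ≡⟨ length-advice (Mat.cols n) (G n) ⟩
    G n * suc (length (Mat.cols n)) + G n * suc (length (Mat.cols n)) ≤⟨ ℕₚ.+-mono-≤ le le ⟩
    ⟦ size ⟧ n       ∎
    where
    open ℕₚ.≤-Reasoning
    le : G n * suc (length (Mat.cols n)) ≤ ⟦ eG ⊗ eC ⟧ n
    le = ℕₚ.*-mono-≤ (ℕₚ.+-mono-≤ (m≤em n) (Γ≤ n))
      (s≤s (ℕₚ.≤-trans (ℕₚ.≤-reflexive (Mat.length-cols n)) (ℕₚ.+-monoʳ-≤ n (ℕₚ.+-monoˡ-≤ 1 (Γ≤ n)))))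

  computes : ∀ n v → isT (scan v (X n) 0 (λ _ → false) false) ≡ g (n + h n) v
  computes n v = let k , e = proj₂ (proj₂ (proj₂ (prog (n + h n)))) v in cong isT (run⇒scan v (X n) k 0 _ _ e)

  accepted⇔ : ∀ n (w : Vec Bool n) → length (toList w) ≡ n →
    AcceptsWithin checker (pair (toList w) (adv n)) (⟦ timeBound ⟧ (length (pair (toList w) (adv n)))) ⇔ (f n w ≡ true)
  accepted⇔ n w len = mk⇔
    (λ a → let c , e = to (Mat.AllSat-cols n w) (to machine a) in from (spec n w) (c , trans (sym (computes n (w ++ᵥ c))) e))
    (λ e → let c , e' = to (spec n w) e in from machine (from (Mat.AllSat-cols n w) (c , trans (computes n (w ++ᵥ c)) e')))
    where
    machine : AcceptsWithin checker (pair (toList w) (adv n)) (⟦ timeBound ⟧ (length (pair (toList w) (adv n)))) ⇔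
      (∃ λ x → AllSat (toList w) (Mat.cols n) x (G n))
    -- The output wire lies below `G n`, so there is at least one row.
    machine = checker-accepts (toList w) (Mat.cols n) (G n) (ℕₚ.≤-<-trans z≤n (Circuit.Wire.bound (Build.result (circuit n))))
      (subst₂ _≤_ (sym len) (sym (Mat.length-cols n)) (ℕₚ.m≤m+n n _))

  adv-correct : ∀ x → toLang f x ≡ checker-decides (pair x (adv (length x)))
  adv-correct x = bool-ext (λ e → from d (from acc e)) (λ e → to acc (to d e))
    where
    n : ℕ
    n = length x
    d : (checker-decides (pair x (adv n)) ≡ true) ⇔ AcceptsWithin checker (pair x (adv n)) (⟦ timeBound ⟧ (length (pair x (adv n))))
    d = proj₂ (proj₂ (proj₂ checker-decides-NP)) (pair x (adv n))
    acc : AcceptsWithin checker (pair x (adv n)) (⟦ timeBound ⟧ (length (pair x (adv n)))) ⇔ (f n (fromList x) ≡ true)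
    acc = subst (λ z → AcceptsWithin checker (pair z (adv n)) (⟦ timeBound ⟧ (length (pair z (adv n)))) ⇔ (f n (fromList x) ≡ true))
      (Vecₚ.toList∘fromList x) (accepted⇔ n (fromList x) (cong length (Vecₚ.toList∘fromList x)))

-- Turing machine configurations in registers

-- On registers this is literally the update made by `doBasic`; the same function serves for tapes.
upd : ∀ {A : Set} → ℕ → A → (ℕ → A) → ℕ → A
upd k b a j = if j ≡ᵇ k then b else a j

upd-same : ∀ {A : Set} k (b : A) a → upd k b a k ≡ b
upd-same k b a rewrite ≡ᵇ-refl k = refl

upd-other : ∀ {A : Set} {k j} (b : A) a → j ≢ k → upd k b a j ≡ a j
upd-other b a ne rewrite ≢⇒≡ᵇ-false ne = refl

-- Uniqueness of division with remainder; it keeps the registers of different cells apart.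
*+-injective : ∀ {S} j j' {i i'} → i < S → i' < S → j * S + i ≡ j' * S + i' → j ≡ j' × i ≡ i'
*+-injective zero zero _ _ e = refl , e
*+-injective {S} zero (suc j') {i} {i'} lt _ e = ⊥-elim (ℕₚ.<⇒≱ lt (subst (S ≤_) (sym e) (ℕₚ.≤-trans (ℕₚ.m≤m+n S (j' * S)) (ℕₚ.m≤m+n _ i'))))
*+-injective {S} (suc j) zero {i} {i'} _ lt e = ⊥-elim (ℕₚ.<⇒≱ lt (subst (S ≤_) e (ℕₚ.≤-trans (ℕₚ.m≤m+n S (j * S)) (ℕₚ.m≤m+n _ i))))
*+-injective {S} (suc j) (suc j') {i} {i'} lt lt' e =
  let p , q = *+-injective j j' lt lt' (ℕₚ.+-cancelˡ-≡ S _ _ (trans (sym (ℕₚ.+-assoc S (j * S) i)) (trans e (ℕₚ.+-assoc S (j' * S) i')))) in cong suc p , q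

module Simulation (M : NTM) (K : ℕ) where
  open NTM M
  open Acceptance M

  S : ℕ
  S = 3 + nextra

  Tr : Set
  Tr = State M × Sym M × Move

  -- Register j * S + toℕ s tells whether tape cell j holds s; it is never read for s = blank.
  writeAux : ℕ → Sym M → ℕ → Aux → Aux
  writeAux p s zero a = a
  writeAux p s (suc i) a = writeAux p s i (upd (p * S + i) (i ≡ᵇ toℕ s) a)

  write : ℕ → Sym M → Aux → Aux
  write p s = writeAux p s S

  -- A cell none of whose nonblank registers is set is blank, so initially all registers may be F.
  readA : ℕ → Aux → (Sym M → Bool) → List (Fin (2 + nextra)) → Bool
  readA p a F [] = F fz
  readA p a F (s ∷ ss) = if a (p * S + toℕ (fs s)) then F (fs s) else readA p a F ss

  nonblanks : List (Fin (2 + nextra))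
  nonblanks = allFin (2 + nextra)

  choose : (ℕ → Bool) → (Tr → Bool) → List Tr → ℕ → Bool
  choose β F [] j = false
  choose β F (tr ∷ trs) j = if β j then F tr else choose β F trs (suc j)

  mvp : Move → ℕ → ℕ
  mvp left p = pred p
  mvp right p = suc p
  mvp stay p = p

  -- With suc r steps left, β (r * K + i) tells whether to take option i, unless an earlier one was taken.
  accA : (ℕ → Bool) → ℕ → State M → ℕ → Aux → Bool
  nextA : (ℕ → Bool) → ℕ → ℕ → Aux → Tr → Bool
  accA β zero q p a = does (q Finₚ.≟ accept)
  accA β (suc r) q p a = if does (q Finₚ.≟ accept) then true else
    readA p a (λ s → choose β (nextA β r p a) (δ q s) (r * K)) nonblanks
  nextA β r p a (q' , s' , mv) = accA β r q' (mvp mv p) (write p s' a)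

  Enc : Aux → (ℕ → Sym M) → Set
  Enc a τ = ∀ j (s : Fin (2 + nextra)) → a (j * S + toℕ (fs s)) ≡ (toℕ (fs s) ≡ᵇ toℕ (τ j))

  writeAux-other : ∀ p s k a {j} → (∀ {i} → i < k → j ≢ p * S + i) → writeAux p s k a j ≡ a j
  writeAux-other p s zero a ne = refl
  writeAux-other p s (suc k) a ne = trans (writeAux-other p s k _ (λ lt → ne (ℕₚ.m<n⇒m<1+n lt))) (upd-other _ a (ne ℕₚ.≤-refl))

  writeAux-at : ∀ p s k a {i} → i < k → writeAux p s k a (p * S + i) ≡ (i ≡ᵇ toℕ s)
  writeAux-at p s (suc k) a {i} lt with ℕₚ.m≤n⇒m<n∨m≡n (ℕₚ.≤-pred lt)
  ... | inj₁ lt' = writeAux-at p s k _ lt'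
  ... | inj₂ refl = trans (writeAux-other p s k _ (λ lt' e → ℕₚ.<⇒≢ lt' (sym (ℕₚ.+-cancelˡ-≡ (p * S) _ _ e)))) (upd-same (p * S + i) _ a)

  Enc-write : ∀ {a τ} p s → Enc a τ → Enc (write p s a) (upd p s τ)
  Enc-write {a} {τ} p s enc j t with j ≟ p
  ... | yes refl rewrite upd-same p s τ = writeAux-at p s S a (Finₚ.toℕ<n (fs t))
  ... | no ne rewrite upd-other {k = p} {j} s τ ne = trans (writeAux-other p s S a (λ lt e → ne (proj₁ (*+-injective j p (Finₚ.toℕ<n (fs t)) lt e)))) (enc j t)

  readA-correct : ∀ {a τ} p F → Enc a τ → readA p a F nonblanks ≡ F (τ p)
  readA-correct {a} {τ} p F enc = go nonblanks (λ s _ → ∈-allFin s)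
    where
    -- Invariant: a nonblank content of the cell is still among the symbols to be tested.
    go : ∀ ss → (∀ s → τ p ≡ fs s → s ∈ ss) → readA p a F ss ≡ F (τ p)
    go [] h with τ p
    ... | fz = refl
    ... | fs s with h s refl
    ... | ()
    go (s ∷ ss) h rewrite enc p s with toℕ (fs s) ≡ᵇ toℕ (τ p) in eq
    ... | true = cong F (Finₚ.toℕ-injective (ℕₚ.≡ᵇ⇒≡ (toℕ (fs s)) (toℕ (τ p)) (subst T (sym eq) tt)))
    ... | false = go ss h'
      where
      h' : ∀ s' → τ p ≡ fs s' → s' ∈ ss
      h' s' e with h s' e
      ... | there i = i
      ... | here refl with trans (sym (≡ᵇ-refl (toℕ (fs s)))) (trans (cong (λ t → toℕ (fs s) ≡ᵇ toℕ t) (sym e)) eq)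
      ... | ()

  nthS : List (Sym M) → ℕ → Sym M
  nthS [] i = blank M
  nthS (s ∷ l) zero = s
  nthS (s ∷ l) (suc i) = nthS l i

  -- The equation i + suc j ≡ p avoids truncated subtraction. Nothing is claimed to the left of cell
  -- 0, which the head cannot pass while its position is at least the number of remaining steps.
  Rep : (ℕ → Sym M) → ℕ → Config M → Set
  Rep τ p (cfg q l s r) = τ p ≡ s × (∀ i → τ (p + suc i) ≡ nthS r i) × (∀ i j → i + suc j ≡ p → τ i ≡ nthS l j)

  Rep-write : ∀ {τ p q l s r} q' s' → Rep τ p (cfg q l s r) → Rep (upd p s' τ) p (cfg q' l s' r)
  Rep-write {τ} {p} q' s' (e , er , el) = upd-same p s' τ ,
    (λ i → trans (upd-other {k = p} s' τ (λ e → ℕₚ.m+1+n≢m p e)) (er i)) ,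
    (λ i j e → trans (upd-other {k = p} s' τ (λ i≡p → ℕₚ.m+1+n≢m i (trans e (sym i≡p)))) (el i j e))

  Rep-right : ∀ {τ p q l s r c} → Rep τ p (cfg q l s r) → Rep τ (suc p) (moveHead M right l s r c)
  Rep-right {τ} {p} {q} {l} {s} {r} {cfg _ _ _ _} (e , er , el) = go r er
    where
    el' : ∀ i j → i + suc j ≡ suc p → τ i ≡ nthS (s ∷ l) j
    el' i zero eq = trans (cong τ (ℕₚ.suc-injective (trans (sym (ℕₚ.+-comm i 1)) eq))) e
    el' i (suc j) eq = el i j (ℕₚ.suc-injective (trans (sym (ℕₚ.+-suc i (suc j))) eq))
    go : ∀ r → (∀ i → τ (p + suc i) ≡ nthS r i) → Rep τ (suc p) (moveHead M right l s r (cfg _ _ _ _))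
    go [] er = trans (cong τ (sym (ℕₚ.+-comm p 1))) (er 0) , (λ i → trans (cong τ (sym (ℕₚ.+-suc p (suc i)))) (er (suc i))) , el'
    go (x ∷ r) er = trans (cong τ (sym (ℕₚ.+-comm p 1))) (er 0) , (λ i → trans (cong τ (sym (ℕₚ.+-suc p (suc i)))) (er (suc i))) , el'

  Rep-left : ∀ {τ p q l s r c} → Rep τ (suc p) (cfg q l s r) → Rep τ p (moveHead M left l s r c)
  Rep-left {τ} {p} {q} {l} {s} {r} {cfg _ _ _ _} (e , er , el) = go l el
    where
    er' : ∀ i → τ (p + suc i) ≡ nthS (s ∷ r) i
    er' zero = trans (cong τ (ℕₚ.+-comm p 1)) e
    er' (suc i) = trans (cong τ (ℕₚ.+-suc p (suc i))) (er i)
    go : ∀ l → (∀ i j → i + suc j ≡ suc p → τ i ≡ nthS l j) → Rep τ p (moveHead M left l s r (cfg _ _ _ _))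
    go [] el = el p 0 (ℕₚ.+-comm p 1) , er' , (λ i j eq → el i (suc j) (trans (ℕₚ.+-suc i (suc j)) (cong suc eq)))
    go (x ∷ l) el = el p 0 (ℕₚ.+-comm p 1) , er' , (λ i j eq → el i (suc j) (trans (ℕₚ.+-suc i (suc j)) (cong suc eq)))

  Rep-apply : ∀ {τ p c} q' s' mv → 0 < p → Rep τ p c → Rep (upd p s' τ) (mvp mv p) (apply M c (q' , s' , mv))
  Rep-apply {c = cfg q l s r} q' s' stay _ rep = Rep-write {q = q} {l} {s} {r} q' s' rep
  Rep-apply {p = p} {cfg q l s r} q' s' right _ rep = Rep-right {q = q'} {l} {s'} {r} (Rep-write {p = p} {q} {l} {s} {r} q' s' rep)
  Rep-apply {p = suc p} {cfg q l s r} q' s' left _ rep = Rep-left {q = q'} {l} {s'} {r} (Rep-write {p = suc p} {q} {l} {s} {r} q' s' rep)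

  state-apply : ∀ c q' s' mv → Config.state (apply M c (q' , s' , mv)) ≡ q'
  state-apply (cfg q l s r) q' s' stay = refl
  state-apply (cfg q [] s r) q' s' left = refl
  state-apply (cfg q (x ∷ l) s r) q' s' left = refl
  state-apply (cfg q l s []) q' s' right = refl
  state-apply (cfg q l s (x ∷ r)) q' s' right = refl

  choose-sound : ∀ β F trs j → choose β F trs j ≡ true → ∃ λ tr → tr ∈ trs × F tr ≡ true
  choose-sound β F (tr ∷ trs) j e with β j
  ... | true = tr , here refl , e
  ... | false = let tr' , i , e' = choose-sound β F trs (suc j) e in tr' , there i , e'

  Rep-hd : ∀ {τ p} c → Rep τ p c → τ p ≡ Config.hd c
  Rep-hd (cfg _ _ _ _) (e , _) = e

  -- A step uses up one unit of time and moves the head left by at most one cell, so the distance to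
  -- the left end keeps covering the remaining time.
  mvp-≤ : ∀ {r p} mv → suc r ≤ p → r ≤ mvp mv p
  mvp-≤ left (s≤s le) = le
  mvp-≤ right le = ℕₚ.≤-trans (ℕₚ.n≤1+n _) (ℕₚ.m≤n⇒m≤1+n le)
  mvp-≤ stay le = ℕₚ.≤-trans (ℕₚ.n≤1+n _) le

  accA-sound : ∀ β r {p a τ} c → r ≤ p → Enc a τ → Rep τ p c → accA β r (Config.state c) p a ≡ true → Acc r c
  accA-sound β zero c _ _ _ e with Config.state c Finₚ.≟ accept
  ... | yes eq = c , ReachWithin.here , eq
  accA-sound β (suc r) {p} {a} {τ} c le enc rep e with Config.state c Finₚ.≟ accept
  ... | yes eq = c , ReachWithin.here , eq
  ... | no _ with choose-sound β (nextA β r p a) (δ (Config.state c) (τ p)) (r * K) (trans (sym (readA-correct {a} {τ} p (λ s → choose β (nextA β r p a) (δ (Config.state c) s) (r * K)) enc)) e)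
  ... | tr@(q' , s' , mv) , i , e' = Acc-step {tr = tr} (subst (λ s → tr ∈ δ (Config.state c) s) (Rep-hd c rep) i)
    (accA-sound β r (apply M c tr) (mvp-≤ mv le) (Enc-write p s' enc) (Rep-apply {c = c} q' s' mv (ℕₚ.≤-trans (s≤s z≤n) le) rep)
      (subst (λ q → accA β r q (mvp mv p) (write p s' a) ≡ true) (sym (state-apply c q' s' mv)) e'))

  readA-cong : ∀ p a {F F'} ss → (∀ s → F s ≡ F' s) → readA p a F ss ≡ readA p a F' ss
  readA-cong p a [] h = h fz
  readA-cong p a (s ∷ ss) h = cong₂ (if a (p * S + toℕ (fs s)) then_else_) (h (fs s)) (readA-cong p a ss h)

  module _ (δ≤K : ∀ q s → length (δ q s) ≤ K) where

    choose-cong : ∀ {β β' F F'} trs j → (∀ {i} → i < j + length trs → β i ≡ β' i) → (∀ tr → F tr ≡ F' tr) → choose β F trs j ≡ choose β' F' trs j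
    choose-cong [] j h hF = refl
    choose-cong {β} {β'} (tr ∷ trs) j h hF rewrite h {j} (ℕₚ.m<m+n j (s≤s z≤n)) with β' j
    ... | true = hF tr
    ... | false = choose-cong trs (suc j) (λ {i} lt → h (subst (i <_) (sym (ℕₚ.+-suc j (length trs))) lt)) hF

    -- The last r steps consult only the choice bits below r * K, so the bits of an earlier step can
    -- be set independently of them.
    accA-cong : ∀ {β β'} r q p a → (∀ {i} → i < r * K → β i ≡ β' i) → accA β r q p a ≡ accA β' r q p a
    accA-cong zero q p a h = refl
    accA-cong {β} {β'} (suc r) q p a h with does (q Finₚ.≟ accept)
    ... | true = refl
    ... | false = readA-cong p a nonblanks λ s → choose-cong (δ q s) (r * K)
      (λ lt → h (ℕₚ.<-≤-trans lt (ℕₚ.≤-trans (ℕₚ.+-monoʳ-≤ (r * K) (δ≤K q s)) (ℕₚ.≤-reflexive (ℕₚ.+-comm (r * K) K)))))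
      (λ (q' , s' , mv) → accA-cong r q' (mvp mv p) (write p s' a) (λ lt → h (ℕₚ.<-≤-trans lt (ℕₚ.m≤n+m (r * K) K))))

    position : ∀ {tr : Tr} {trs} → tr ∈ trs → ℕ
    position (here _) = 0
    position (there i) = suc (position i)

    choose-complete : ∀ β F {tr trs} (m : tr ∈ trs) j → (∀ i → j ≤ i → β i ≡ (i ≡ᵇ j + position m)) → choose β F trs j ≡ F tr
    choose-complete β F (here refl) j h rewrite h j ℕₚ.≤-refl | ℕₚ.+-identityʳ j | ≡ᵇ-refl j = refl
    choose-complete β F (there m) j h rewrite h j ℕₚ.≤-refl | ≢⇒≡ᵇ-false (λ e → ℕₚ.m+1+n≢m j {position m} (sym e)) =
      choose-complete β F m (suc j) (λ i le → trans (h i (ℕₚ.≤-trans (ℕₚ.n≤1+n j) le)) (cong (i ≡ᵇ_) (ℕₚ.+-suc j (position m))))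

    accA-complete : ∀ r {p a τ} c → r ≤ p → Enc a τ → Rep τ p c → Acc r c → ∃ λ β → accA β r (Config.state c) p a ≡ true
    accA-complete zero c _ _ _ (_ , ReachWithin.here , eq) = (λ _ → false) , lem
      where
      lem : does (Config.state c Finₚ.≟ accept) ≡ true
      lem with Config.state c Finₚ.≟ accept
      ... | yes _ = refl
      ... | no ne = ⊥-elim (ne eq)
    accA-complete (suc r) {p} {a} {τ} c le enc rep acc with Config.state c Finₚ.≟ accept
    ... | yes _ = (λ _ → false) , refl
    ... | no ne with Acc-inv acc
    ... | inj₁ eq = ⊥-elim (ne eq)
    ... | inj₂ (_ , tr@(q' , s' , mv) , refl , m , acc')
      with accA-complete r (apply M c tr) (mvp-≤ mv le) (Enc-write p s' enc) (Rep-apply {c = c} q' s' mv (ℕₚ.≤-trans (s≤s z≤n) le) rep) acc'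
    ... | β' , e = β , (begin
      readA p a (λ s → choose β (nextA β r p a) (δ (Config.state c) s) (r * K)) nonblanks ≡⟨ readA-correct {a} {τ} p (λ s → choose β (nextA β r p a) (δ (Config.state c) s) (r * K)) enc ⟩
      choose β (nextA β r p a) (δ (Config.state c) (τ p)) (r * K) ≡⟨ cong (λ s → choose β (nextA β r p a) (δ (Config.state c) s) (r * K)) (Rep-hd c rep) ⟩
      choose β (nextA β r p a) (δ (Config.state c) (Config.hd c)) (r * K) ≡⟨ choose-complete β (nextA β r p a) m (r * K) above ⟩
      accA β r q' (mvp mv p) (write p s' a)  ≡⟨ accA-cong r q' (mvp mv p) (write p s' a) below ⟩
      accA β' r q' (mvp mv p) (write p s' a) ≡⟨ cong (λ q → accA β' r q (mvp mv p) (write p s' a)) (state-apply c q' s' mv) ⟨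
      accA β' r (Config.state (apply M c tr)) (mvp mv p) (write p s' a) ≡⟨ e ⟩
      true ∎)
      where
      open ≡-Reasoning
      β : ℕ → Bool
      -- The later choices come from the induction hypothesis; above them only the bit of the option
      -- taken now is set.
      β i = if i <ᵇ r * K then β' i else (i ≡ᵇ r * K + position m)
      below : ∀ {i} → i < r * K → β i ≡ β' i
      below {i} lt with i <ᵇ r * K in eq
      ... | true = refl
      ... | false = ⊥-elim (subst T eq (ℕₚ.<⇒<ᵇ lt))
      above : ∀ i → r * K ≤ i → β i ≡ (i ≡ᵇ r * K + position m)
      above i ge with i <ᵇ r * K in eq
      ... | true = ⊥-elim (ℕₚ.<⇒≱ (ℕₚ.<ᵇ⇒< i (r * K) (subst T (sym eq) tt)) ge)
      ... | false = refl

  writeAll : List Bool → ℕ → Aux → Aux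
  writeAll [] p a = a
  writeAll (b ∷ bs) p a = writeAll bs (suc p) (write p (bitSym M b) a)

  tapeAll : List Bool → ℕ → (ℕ → Sym M) → ℕ → Sym M
  tapeAll [] p τ = τ
  tapeAll (b ∷ bs) p τ = tapeAll bs (suc p) (upd p (bitSym M b) τ)

  Enc-writeAll : ∀ {a τ} bs p → Enc a τ → Enc (writeAll bs p a) (tapeAll bs p τ)
  Enc-writeAll [] p enc = enc
  Enc-writeAll (b ∷ bs) p enc = Enc-writeAll bs (suc p) (Enc-write p (bitSym M b) enc)

  tapeAll-below : ∀ bs p τ {j} → j < p → tapeAll bs p τ j ≡ τ j
  tapeAll-below [] p τ lt = refl
  tapeAll-below (b ∷ bs) p τ lt = trans (tapeAll-below bs (suc p) _ (ℕₚ.m<n⇒m<1+n lt)) (upd-other _ τ (ℕₚ.<⇒≢ lt))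

  tapeAll-at : ∀ bs p τ i → (∀ {j} → p ≤ j → τ j ≡ blank M) → tapeAll bs p τ (p + i) ≡ nthS (map (bitSym M) bs) i
  tapeAll-at [] p τ i h = h (ℕₚ.m≤m+n p i)
  tapeAll-at (b ∷ bs) p τ zero h rewrite ℕₚ.+-identityʳ p = trans (tapeAll-below bs (suc p) _ ℕₚ.≤-refl) (upd-same p _ τ)
  tapeAll-at (b ∷ bs) p τ (suc i) h = trans (cong (tapeAll bs (suc p) _) (ℕₚ.+-suc p i))
    (tapeAll-at bs (suc p) _ i (λ {j} lt → trans (upd-other _ τ (λ e → ℕₚ.<⇒≢ lt (sym e))) (h (ℕₚ.<⇒≤ lt))))

  blankAux : Aux
  blankAux _ = false

  Enc-blank : Enc blankAux (λ _ → blank M)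
  Enc-blank j s = refl

  Rep-init : ∀ bs p → Rep (tapeAll bs p (λ _ → blank M)) p (initConfig M bs)
  Rep-init bs p = go bs refl
    where
    τ : ℕ → Sym M
    τ = tapeAll bs p (λ _ → blank M)
    below : ∀ i j → i + suc j ≡ p → τ i ≡ blank M
    below i j e = tapeAll-below bs p _ (subst (i <_) e (ℕₚ.m<m+n i (s≤s z≤n)))
    at : ∀ i → τ (p + i) ≡ nthS (map (bitSym M) bs) i
    at i = tapeAll-at bs p _ i (λ _ → refl)
    go : ∀ bs' → bs ≡ bs' → Rep τ p (initConfig M bs')
    go [] refl = refl , (λ i → refl) , below
    go (b ∷ bs') refl = trans (cong τ (sym (ℕₚ.+-identityʳ p))) (at 0) , (λ i → at (suc i)) , below

-- Instruction sequences simulating a Turing machine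

buildAll : ∀ {A : Set} N k {xs : List A} (R : Fin N → List A → Set) → (∀ i {ys zs} → ys ⊑ zs → R i ys → R i zs) →
  (∀ i {ys} → xs ⊑ ys → Build k ys (R i)) → Build (N * k) xs (λ ys → ∀ i → R i ys)
buildAll zero k R lft b = return (λ ())
buildAll (suc N) k R lft b = b fz ⊑-refl >>= λ e r →
  map-result (λ { (e' , r' , rs) fz → r' ; (e' , r' , rs) (fs i) → rs i })
    (buildAll N k (R ∘ fs) (λ i → lft (fs i)) (λ i e' → b (fs i) (⊑-trans e e')) |> r)
  where
  infixl 0 _|>_
  _|>_ : ∀ {j xs} {T : List _ → Set} → Build j xs T → R fz xs → Build j xs (λ ys → xs ⊑ ys × R fz ys × T ys)
  built e s t |> r = built e s (e , lft fz e r , t)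

lookup-nth : ∀ {n} (v : Vec Bool n) {k} (lt : k < n) → lookup v (fromℕ< lt) ≡ nth v k
lookup-nth (b ∷ v) {zero} (s≤s lt) = refl
lookup-nth (b ∷ v) {suc k} (s≤s lt) = lookup-nth v lt

module Code (m : ℕ) where

  -- A code position is named by the number of instructions from it to the end, so names survive prepending.
  record Entry (φ : Vec Bool m → Aux → Bool) (Y : InstrSeq) : Set where
    constructor entry
    field
      label : ℕ
      bound : label ≤ length Y
      correct : ∀ v a → scan v Y (length Y ∸ label) a false ≡ terminated (φ v a)
  open Entry

  skip-cons : ∀ {φ Y u} (e : Entry φ Y) v a → scan v (u ∷ Y) (length (u ∷ Y) ∸ label e) a false ≡ terminated (φ v a)
  skip-cons {φ} {Y} {u} e v a = trans (cong (λ d → scan v (u ∷ Y) d a false) (ℕₚ.+-∸-assoc 1 (bound e))) (correct e v a)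

  lift : ∀ {φ Y Y'} → Y ⊑ Y' → Entry φ Y → Entry φ Y'
  lift ⊑-refl e = e
  lift (⊑-cons s) e = let e' = lift s e in entry (label e') (ℕₚ.m≤n⇒m≤1+n (bound e')) (skip-cons e')

  recast : ∀ {φ ψ Y} → (∀ v a → φ v a ≡ ψ v a) → Entry φ Y → Entry ψ Y
  recast h (entry l b c) = entry l b (λ v a → trans (c v a) (cong terminated (h v a)))

  front : ∀ {φ Y} → (∀ v a → scan v Y 0 a false ≡ terminated (φ v a)) → Entry φ Y
  front {φ} {Y} c = entry (length Y) ℕₚ.≤-refl (λ v a → trans (cong (λ d → scan v Y d a false) (ℕₚ.n∸n≡0 (length Y))) (c v a))

  -- The jump stands directly in front of Y, hence one more than the number of instructions of Y to
  -- be skipped; it is never the inactive jump 0.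
  jumpTo : ∀ {φ Y} → Entry φ Y → Prim
  jumpTo {Y = Y} e = jump (suc (length Y ∸ label e))

  rejectE : ∀ {Y} → Build 1 Y (Entry (λ _ _ → false))
  rejectE = built (⊑-cons {y = halt} ⊑-refl) ℕₚ.≤-refl (front (λ v a → refl))

  acceptE : ∀ {Y} → Build 2 Y (Entry (λ _ _ → true))
  acceptE = built (⊑-cons {y = plain (outSet true)} (⊑-cons {y = halt} ⊑-refl)) ℕₚ.≤-refl (front (λ v a → refl))

  -- Code is generated backwards: the continuation exists first, and an instruction in front of it
  -- acts by substitution, as in a weakest precondition.
  setE : ∀ {φ Y} k b → Entry φ Y → Build 2 Y (Entry (λ v a → φ v (upd k b a)))
  setE k b e = built (⊑-cons {y = plain (auxSet k b)} (⊑-cons {y = jumpTo e} ⊑-refl)) ℕₚ.≤-refl (front (λ v a → correct e v _))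

  branchE : ∀ {φ ψ Y} b (R : Vec Bool m → Aux → Bool) → (∀ v a o → doBasic v b a o ≡ just (a , o , R v a)) →
    Entry φ Y → Entry ψ Y → Build 3 Y (Entry (λ v a → if R v a then φ v a else ψ v a))
  branchE {φ} {ψ} {Y} b R D e₁ e₂ = built (⊑-cons {y = ptest b} (⊑-cons {y = jumpTo e₁'} (⊑-cons {y = jumpTo e₂} ⊑-refl))) ℕₚ.≤-refl (front c)
    where
    e₁' : Entry φ (jumpTo e₂ ∷ Y)
    e₁' = lift (⊑-cons ⊑-refl) e₁
    c : ∀ v a → scan v (ptest b ∷ jumpTo e₁' ∷ jumpTo e₂ ∷ Y) 0 a false ≡ terminated (if R v a then φ v a else ψ v a)
    c v a rewrite D v a false with R v a
    ... | true = correct e₁' v a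
    ... | false = correct e₂ v a

  inputE : ∀ {φ ψ Y k} → k < m → Entry φ Y → Entry ψ Y → Build 3 Y (Entry (λ v a → if nth v k then φ v a else ψ v a))
  inputE {k = k} lt = branchE (inGet k) (λ v a → nth v k) (λ v a o → trans (doBasic-inGet v lt a o) (cong (λ b → just (a , o , b)) (lookup-nth v lt)))

-- These counts depend on the machine alone and so enter the final size bound as constant
-- coefficients. The 2 in `blockCost` covers the block of the accepting state, the 1 in `chainCost`
-- the rejection when no option is taken.
module Cost (M : NTM) (K : ℕ) where
  open NTM M
  open Simulation M K using (S)

  optionCost chainCost blockCost tableCost loadCost : ℕ
  optionCost = S * 2 + 3
  chainCost = 1 + K * optionCost
  blockCost = 2 + (S * chainCost + (2 + nextra) * 3)
  tableCost = suc nstates * blockCost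
  loadCost = S * 2 + (S * 2 + 3)

module Compile (M : NTM) (K : ℕ) (δ≤K : ∀ q s → length (NTM.δ M q s) ≤ K) (n m W : ℕ) where
  open NTM M
  open Simulation M K
  open Cost M K
  open Code m

  writeAuxE : ∀ {φ Y} p s i → Entry φ Y → Build (i * 2) Y (Entry (λ v a → φ v (writeAux p s i a)))
  writeAuxE p s zero e = return e
  writeAuxE {φ} p s (suc i) e = weaken (ℕₚ.≤-reflexive (ℕₚ.+-comm (i * 2) 2))
    (writeAuxE p s i e >>= λ _ e' → setE (p * S + i) (i ≡ᵇ toℕ s) e')

  writeE : ∀ {φ Y} p s → Entry φ Y → Build (S * 2) Y (Entry (λ v a → φ v (write p s a)))
  writeE p s = writeAuxE p s S

  readE : ∀ {Y} {φ : Sym M → Vec Bool m → Aux → Bool} p → (∀ s → Entry (φ s) Y) → ∀ ss →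
    Build (length ss * 3) Y (Entry (λ v a → readA p a (λ s → φ s v a) ss))
  readE p es [] = return (es fz)
  readE p es (s ∷ ss) = weaken (ℕₚ.≤-reflexive (ℕₚ.+-comm (length ss * 3) 3))
    (readE p es ss >>= λ e r → branchE (auxGet (p * S + toℕ (fs s))) (λ v a → a (p * S + toℕ (fs s))) (λ v a o → refl) (lift e (es (fs s))) r)

  β : Vec Bool m → ℕ → Bool
  β v j = nth v (n + j)

  chooseE : ∀ {Y} {F : Tr → Vec Bool m → Aux → Bool} → (∀ tr {Y'} → Y ⊑ Y' → Build (S * 2) Y' (Entry (F tr))) →
    ∀ trs j → n + (j + length trs) ≤ m → Build (1 + length trs * optionCost) Y (Entry (λ v a → choose (β v) (λ tr → F tr v a) trs j))
  chooseE b [] j le = rejectE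
  chooseE b (tr ∷ trs) j le = weaken (s≤s (ℕₚ.≤-reflexive (ℕₚ.+-comm (length trs * optionCost) optionCost)))
    (chooseE b trs (suc j) (subst (λ z → n + z ≤ m) (ℕₚ.+-suc j (length trs)) le) >>= λ e r →
     b tr e >>= λ e' r' → inputE (ℕₚ.<-≤-trans (ℕₚ.+-monoʳ-< n (ℕₚ.m<m+n j (s≤s z≤n))) le) r' (lift e' r))

  Table : ℕ → InstrSeq → Set
  Table r Y = ∀ q p → p + r < W → Entry (λ v a → accA (β v) r q p a) Y

  mvp-< : ∀ mv {p r} → p + suc r < W → mvp mv p + r < W
  mvp-< left {zero} {r} lt = ℕₚ.<-trans ℕₚ.≤-refl lt
  mvp-< left {suc p} {r} lt = ℕₚ.<-trans (ℕₚ.+-monoʳ-< p ℕₚ.≤-refl) (ℕₚ.<-trans ℕₚ.≤-refl lt)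
  mvp-< right {p} {r} lt = subst (_< W) (ℕₚ.+-suc p r) lt
  mvp-< stay {p} lt = ℕₚ.<-trans (ℕₚ.+-monoʳ-< p ℕₚ.≤-refl) lt

  -- Unfolding `accA` would give a tree of exponential size. All blocks for suc r instead jump into
  -- the one table for r, so their number stays polynomial.
  blockE : ∀ {Y r} → n + suc r * K ≤ m → Table r Y → ∀ q p → p + suc r < W → ∀ {Y'} → Y ⊑ Y' →
    Build blockCost Y' (Entry (λ v a → accA (β v) (suc r) q p a))
  blockE {Y} {r} le table q p lt {Y'} e = byState (q Finₚ.≟ accept)
    where
    next : ∀ tr {Y''} → Y' ⊑ Y'' → Build (S * 2) Y'' (Entry (λ v a → nextA (β v) r p a tr))
    next (q' , s' , mv) e' = writeE p s' (lift (⊑-trans e e') (table q' (mvp mv p) (mvp-< mv lt)))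
    chain : ∀ s {Y''} → Y' ⊑ Y'' → Build chainCost Y'' (Entry (λ v a → choose (β v) (nextA (β v) r p a) (δ q s) (r * K)))
    chain s e' = weaken (s≤s (ℕₚ.*-monoˡ-≤ optionCost (δ≤K q s))) (chooseE (λ tr e'' → next tr (⊑-trans e' e'')) (δ q s) (r * K)
      (ℕₚ.≤-trans (ℕₚ.+-monoʳ-≤ n (ℕₚ.≤-trans (ℕₚ.+-monoʳ-≤ (r * K) (δ≤K q s)) (ℕₚ.≤-reflexive (ℕₚ.+-comm (r * K) K)))) le))
    read : Build (S * chainCost + length nonblanks * 3) Y' (Entry (λ v a → readA p a (λ s → choose (β v) (nextA (β v) r p a) (δ q s) (r * K)) nonblanks))
    read = buildAll S chainCost _ (λ s → lift) chain >>= λ _ es → readE p es nonblanks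
    byState : (d : Dec (q ≡ accept)) → Build blockCost Y' (Entry (λ v a →
      if does d then true else readA p a (λ s → choose (β v) (nextA (β v) r p a) (δ q s) (r * K)) nonblanks))
    byState (yes _) = weaken (ℕₚ.m≤m+n 2 _) acceptE
    byState (no _) = weaken (ℕₚ.≤-trans (ℕₚ.≤-reflexive (cong (λ z → S * chainCost + z * 3) (Listₚ.length-tabulate {n = 2 + nextra} (λ i → i)))) (ℕₚ.m≤n+m _ 2)) read

  tableSuc : ∀ {Y r} → n + suc r * K ≤ m → Table r Y → Build (W * tableCost) Y (Table (suc r))
  tableSuc {Y} {r} le table = map-result convert
    (buildAll W tableCost (λ p Y' → ∀ q → toℕ p + suc r < W → Entry (E q (toℕ p)) Y') (λ p e t q lt → lift e (t q lt))
      (λ p e → buildAll (suc nstates) blockCost (λ q Y' → toℕ p + suc r < W → Entry (E q (toℕ p)) Y') (λ q e' t lt → lift e' (t lt))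
        (λ q e' → slot q (toℕ p) (⊑-trans e e') (suc (toℕ p + suc r) ≤? W))))
    where
    E : State M → ℕ → Vec Bool m → Aux → Bool
    E q p v a = accA (β v) (suc r) q p a
    slot : ∀ q p {Y'} → Y ⊑ Y' → Dec (p + suc r < W) → Build blockCost Y' (λ Y'' → p + suc r < W → Entry (E q p) Y'')
    slot q p e (yes lt) = map-result (λ r _ → r) (blockE le table q p lt e)
    -- Positions outside the window get no code.
    slot q p e (no ¬lt) = weaken z≤n (return (λ lt → ⊥-elim (¬lt lt)))
    convert : ∀ {Y'} → (∀ p q → toℕ p + suc r < W → Entry (E q (toℕ p)) Y') → Table (suc r) Y'
    convert t q p lt = subst (λ p → p + suc r < W → Entry (E q p) _) (Finₚ.toℕ-fromℕ< p<W) (t (fromℕ< p<W) q) lt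
      where
      p<W : p < W
      p<W = ℕₚ.≤-<-trans (ℕₚ.m≤m+n p (suc r)) lt

  tableZero : Build 3 [] (Table 0)
  tableZero = acceptE >>= λ _ yesE → rejectE >>= λ e noE → return (λ q p _ → byState (lift e yesE) noE (q Finₚ.≟ accept))
    where
    byState : ∀ {Y q} → Entry (λ _ _ → true) Y → Entry (λ _ _ → false) Y → (d : Dec (q ≡ accept)) → Entry (λ _ _ → does d) Y
    byState y n (yes _) = y
    byState y n (no _) = n

  tableE : ∀ r → n + r * K ≤ m → Build (3 + r * (W * tableCost)) [] (Table r)
  tableE zero le = tableZero
  tableE (suc r) le = weaken (s≤s (s≤s (s≤s (ℕₚ.≤-reflexive (ℕₚ.+-comm (r * (W * tableCost)) _)))))
    (tableE r (ℕₚ.≤-trans (ℕₚ.+-monoʳ-≤ n (ℕₚ.m≤n+m (r * K) K)) le) >>= λ _ t → tableSuc le t)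

  -- At a fixed length the word given to the machine mixes input bits with the known bits of the
  -- separator and the advice.
  data Src : Set where
    const : Bool → Src
    input : ∀ k → k < m → Src

  value : Vec Bool m → Src → Bool
  value v (const b) = b
  value v (input k _) = nth v k

  loadE : ∀ {φ Y} srcs p → Entry φ Y → Build (length srcs * loadCost) Y (Entry (λ v a → φ v (writeAll (map (value v) srcs) p a)))
  loadE [] p e = return e
  loadE {φ} (src ∷ srcs) p e = weaken (ℕₚ.≤-reflexive (ℕₚ.+-comm (length srcs * loadCost) loadCost))
    (loadE srcs (suc p) e >>= λ _ e' → one src e')
    where
    ψ : Vec Bool m → Aux → Bool
    ψ v a = φ v (writeAll (map (value v) srcs) (suc p) a)
    one : ∀ {Y} src → Entry ψ Y → Build loadCost Y (Entry (λ v a → ψ v (write p (bitSym M (value v src)) a)))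
    one (const b) e = weaken (ℕₚ.m≤m+n (S * 2) _) (writeE p (bitSym M b) e)
    one (input k lt) e = writeE p (bitSym M true) e >>= λ s t → writeE p (bitSym M false) (lift s e) >>= λ s' f →
      map-result (recast λ v a → lem (nth v k) v a) (inputE lt (lift s' t) f)
      where
      lem : ∀ b v a → (if b then ψ v (write p (bitSym M true) a) else ψ v (write p (bitSym M false) a)) ≡ ψ v (write p (bitSym M b) a)
      lem false v a = refl
      lem true v a = refl

  program : ∀ T (srcs : List Src) p₀ → n + T * K ≤ m → p₀ + T < W → Σ InstrSeq λ X → NonEmpty X ×
    length X ≤ 1 + (3 + T * (W * tableCost) + length srcs * loadCost) ×
    Computes m X (λ v → accA (β v) T fz p₀ (writeAll (map (value v) srcs) p₀ blankAux))
  program T srcs p₀ le lt with (tableE T le >>= (λ _ t → loadE srcs p₀ (t fz p₀ lt)))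
  ... | built {Y} _ size e = jumpTo e ∷ Y , s≤s z≤n , s≤s (ℕₚ.≤-trans size (ℕₚ.≤-reflexive (ℕₚ.+-identityʳ _))) ,
    λ v → suc (length (jumpTo e ∷ Y)) , trans (run≡scan v (jumpTo e ∷ Y) _ 0 _ _ (ℕₚ.≤-reflexive (sym (ℕₚ.+-identityʳ _)))) (Entry.correct e v blankAux)

-- NP/poly is contained in NP-IS

finite-bound : ∀ {n} (f : Fin n → ℕ) → ∃ λ K → ∀ i → f i ≤ K
finite-bound {zero} f = 0 , λ ()
finite-bound {suc n} f = let K , h = finite-bound (f ∘ fs) in
  f fz + K , λ { fz → ℕₚ.m≤m+n _ K ; (fs i) → ℕₚ.≤-trans (h i) (ℕₚ.m≤n+m K (f fz)) }

δ-bound : ∀ M → ∃ λ K → ∀ q s → length (NTM.δ M q s) ≤ K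
δ-bound M = let K , h = finite-bound (λ q → proj₁ (bounds q)) in K , λ q s → ℕₚ.≤-trans (proj₂ (bounds q) s) (h q)
  where
  bounds : ∀ q → ∃ λ K → ∀ s → length (NTM.δ M q s) ≤ K
  bounds q = finite-bound (λ s → length (NTM.δ M q s))

nth-++ˡ : ∀ {n h} (w : Vec Bool n) (c : Vec Bool h) {i} → i < n → nth (w ++ᵥ c) i ≡ nth w i
nth-++ˡ (b ∷ w) c {zero} _ = refl
nth-++ˡ (b ∷ w) c {suc i} (s≤s lt) = nth-++ˡ w c lt

nth-++ʳ : ∀ {n h} (w : Vec Bool n) (c : Vec Bool h) j → nth (w ++ᵥ c) (n + j) ≡ nth c j
nth-++ʳ [] c j = refl
nth-++ʳ (b ∷ w) c j = nth-++ʳ w c j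

nth-tabulate : ∀ {h} (β : ℕ → Bool) {j} → j < h → nth (tabulate {n = h} (β ∘ toℕ)) j ≡ β j
nth-tabulate {suc h} β {zero} _ = refl
nth-tabulate {suc h} β {suc j} (s≤s lt) = nth-tabulate (β ∘ suc) lt

-- Generalising over f allows the induction to shift the family by one length, so no transport along
-- an equation between lengths arises.
toLang-toList : ∀ (f : BFamily) {n} (w : Vec Bool n) → toLang f (toList w) ≡ f n w
toLang-toList f [] = refl
toLang-toList f (b ∷ w) = toLang-toList (λ k u → f (suc k) (b ∷ u)) w

double : List Bool → List Bool
double = concatMap (λ b → b ∷ b ∷ [])

length-double : ∀ x → length (double x) ≡ length x + length x
length-double [] = refl
length-double (b ∷ x) = cong suc (trans (cong suc (length-double x)) (sym (ℕₚ.+-suc (length x) (length x))))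

length-pair : ∀ x y → length (pair x y) ≡ length x + length x + (2 + length y)
length-pair x y = trans (Listₚ.length-++ (double x)) (cong (_+ (2 + length y)) (length-double x))

module _ (f : BFamily) {L' : List Bool → Bool} (M : NTM) {p : ℕ → ℕ} (pp : IsPolynomial p)
  (decides : ∀ y → (L' y ≡ true) ⇔ AcceptsWithin M y (p (length y)))
  (adv : ℕ → List Bool) {q : ℕ → ℕ} (pq : IsPolynomial q) (adv≤ : ∀ n → length (adv n) ≤ q n)
  (reduces : ∀ x → toLang f x ≡ L' (pair x (adv (length x)))) where

  private
    K : ℕ
    K = proj₁ (δ-bound M)

    open Simulation M K
    open Acceptance M
    open Cost M K

    -- The certificate length has to be a monotonic polynomial in n, whereas the exact number of
    -- choices depends on the advice length and on p. It is rounded up, and the surplus bits are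
    -- padding.
    eN eT eh : Poly
    eN = var ⊕ var ⊕ (con 2 ⊕ proj₁ (dominated {q} pq))
    eT = proj₁ (dominated {p} pp) ⟪ eN ⟫
    eh = eT ⊗ con K

    h : ℕ → ℕ
    h = ⟦ eh ⟧

    N steps : ℕ → ℕ
    N n = n + n + (2 + length (adv n))
    steps n = p (N n)

    N≤ : ∀ n → N n ≤ ⟦ eN ⟧ n
    N≤ n = ℕₚ.+-monoʳ-≤ (n + n) (ℕₚ.+-monoʳ-≤ 2 (ℕₚ.≤-trans (adv≤ n) (proj₂ (dominated {q} pq) n)))

    steps≤ : ∀ n → steps n ≤ ⟦ eT ⟧ n
    steps≤ n = begin
      p (N n)                                 ≤⟨ proj₂ (dominated {p} pp) (N n) ⟩
      ⟦ proj₁ (dominated {p} pp) ⟧ (N n)      ≤⟨ ⟦⟧-mono (proj₁ (dominated {p} pp)) (N≤ n) ⟩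
      ⟦ proj₁ (dominated {p} pp) ⟧ (⟦ eN ⟧ n) ≡⟨ ⟪⟫-eval (proj₁ (dominated {p} pp)) eN n ⟨
      ⟦ eT ⟧ n                                ∎
      where open ℕₚ.≤-Reasoning

    choices≤ : ∀ n → steps n * K ≤ h n
    choices≤ n = ℕₚ.*-monoˡ-≤ K (steps≤ n)

    -- The head starts at cell steps n and so stays within the first W n cells.
    W : ℕ → ℕ
    W n = suc (steps n + steps n)

    module C (n : ℕ) = Compile M K (proj₂ (δ-bound M)) n (n + h n) (W n)

    doubled : ∀ n k i → i + k ≤ n → List (C.Src n)
    doubled n zero i le = []
    doubled n (suc k) i le = C.input i lt ∷ C.input i lt ∷ doubled n k (suc i) (ℕₚ.≤-trans (ℕₚ.≤-reflexive (sym (ℕₚ.+-suc i k))) le)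
      where
      lt : i < n + h n
      lt = ℕₚ.<-≤-trans (ℕₚ.m<m+n i (s≤s z≤n)) (ℕₚ.≤-trans le (ℕₚ.m≤m+n n (h n)))

    srcs : ∀ n → List (C.Src n)
    srcs n = doubled n n 0 ℕₚ.≤-refl ++ C.const false ∷ C.const true ∷ map C.const (adv n)

    doubled-value : ∀ n v k i le (w : Vec Bool k) → (∀ {j} → j < k → nth v (i + j) ≡ nth w j) →
      map (C.value n v) (doubled n k i le) ≡ double (toList w)
    doubled-value n v zero i le [] eq = refl
    doubled-value n v (suc k) i le (b ∷ w) eq = cong₂ (λ c z → c ∷ c ∷ z) (trans (cong (nth v) (sym (ℕₚ.+-identityʳ i))) (eq (s≤s z≤n)))
      (doubled-value n v k (suc i) _ w (λ {j} lt → trans (cong (nth v) (sym (ℕₚ.+-suc i j))) (eq (s≤s lt))))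

    srcs-value : ∀ n (w : Vec Bool n) c → map (C.value n (w ++ᵥ c)) (srcs n) ≡ pair (toList w) (adv n)
    srcs-value n w c = trans (Listₚ.map-++ (C.value n (w ++ᵥ c)) (doubled n n 0 ℕₚ.≤-refl) _)
      (cong₂ _++_ (doubled-value n (w ++ᵥ c) n 0 ℕₚ.≤-refl w (nth-++ˡ w c))
        (cong (λ z → false ∷ true ∷ z) (trans (sym (Listₚ.map-∘ (adv n))) (Listₚ.map-id (adv n)))))

    verifier : ∀ n → Vec Bool (n + h n) → Bool
    verifier n v = accA (C.β n v) (steps n) fz (steps n) (writeAll (map (C.value n v) (srcs n)) (steps n) blankAux)

    start-state : ∀ y → Config.state (initConfig M y) ≡ fz
    start-state [] = refl
    start-state (_ ∷ _) = refl

    verifier-correct : ∀ n (w : Vec Bool n) → (∃ λ c → verifier n (w ++ᵥ c) ≡ true) ⇔ Acc (steps n) (initConfig M (pair (toList w) (adv n)))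
    verifier-correct n w = mk⇔ sound complete
      where
      y : List Bool
      y = pair (toList w) (adv n)
      value : (ℕ → Bool) → Bool
      value β = accA β (steps n) (Config.state (initConfig M y)) (steps n) (writeAll y (steps n) blankAux)
      verifier≡ : ∀ c → verifier n (w ++ᵥ c) ≡ value (C.β n (w ++ᵥ c))
      verifier≡ c = cong₂ (λ q bs → accA (C.β n (w ++ᵥ c)) (steps n) q (steps n) (writeAll bs (steps n) blankAux)) (sym (start-state y)) (srcs-value n w c)
      sound : (∃ λ c → verifier n (w ++ᵥ c) ≡ true) → Acc (steps n) (initConfig M y)
      sound (c , e) = accA-sound (C.β n (w ++ᵥ c)) (steps n) (initConfig M y) ℕₚ.≤-refl (Enc-writeAll y (steps n) Enc-blank) (Rep-init y (steps n))
        (trans (sym (verifier≡ c)) e)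
      complete : Acc (steps n) (initConfig M y) → ∃ λ c → verifier n (w ++ᵥ c) ≡ true
      complete acc with accA-complete (proj₂ (δ-bound M)) (steps n) (initConfig M y) ℕₚ.≤-refl (Enc-writeAll y (steps n) Enc-blank) (Rep-init y (steps n)) acc
      ... | β , e = c , trans (verifier≡ c) (trans (accA-cong (proj₂ (δ-bound M)) (steps n) _ (steps n) _ agree) e)
        where
        c : Vec Bool (h n)
        c = tabulate (β ∘ toℕ)
        agree : ∀ {j} → j < steps n * K → C.β n (w ++ᵥ c) j ≡ β j
        agree {j} lt = trans (nth-++ʳ w c j) (nth-tabulate β (ℕₚ.<-≤-trans lt (choices≤ n)))

    -- Monotonicity of h makes the total length strictly increasing, so the length of an argument of
    -- g determines where it splits.
    total-injective : ∀ {n n'} → n + h n ≡ n' + h n' → n ≡ n'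
    total-injective {n} {n'} e with ℕₚ.<-cmp n n'
    ... | tri< lt _ _ = ⊥-elim (ℕₚ.<⇒≢ (ℕₚ.+-mono-<-≤ lt (⟦⟧-mono eh (ℕₚ.<⇒≤ lt))) e)
    ... | tri≈ _ eq _ = eq
    ... | tri> _ _ gt = ⊥-elim (ℕₚ.<⇒≢ (ℕₚ.+-mono-<-≤ gt (⟦⟧-mono eh (ℕₚ.<⇒≤ gt))) (sym e))

    -- The bound on n makes the search finite and later lets a size bound in n pass to one in m.
    Total : ℕ → Set
    Total m = ∃ λ n → n < suc m × n + h n ≡ m

    total? : ∀ m → Dec (Total m)
    total? m = ℕₚ.anyUpTo? (λ n → n + h n ≟ m) (suc m)

    -- The argument is split as w ++ c; lengths not of the form n + h n are irrelevant.
    g-by : ∀ {m} → Dec (Total m) → Vec Bool m → Bool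
    g-by (yes (n , _ , refl)) v = verifier n v
    g-by (no _) v = false

    g : BFamily
    g m = g-by (total? m)

    g-verifier : ∀ n v → g (n + h n) v ≡ verifier n v
    g-verifier n v with total? (n + h n)
    ... | no ¬t = ⊥-elim (¬t (n , s≤s (ℕₚ.m≤m+n n (h n)) , refl))
    ... | yes (n' , lt , e) with total-injective e
    ... | refl = cong (λ e → g-by (yes (n' , lt , e)) v) (ℕₚ.≡-irrelevant e refl)

    size : Poly
    size = con 1 ⊕ (con 3 ⊕ eT ⊗ ((con 1 ⊕ (eT ⊕ eT)) ⊗ con tableCost) ⊕ eN ⊗ con loadCost)

    length-doubled : ∀ n k i le → length (doubled n k i le) ≡ k + k
    length-doubled n zero i le = refl
    length-doubled n (suc k) i le = cong suc (trans (cong suc (length-doubled n k (suc i) _)) (sym (ℕₚ.+-suc k k)))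

    length-srcs : ∀ n → length (srcs n) ≡ N n
    length-srcs n = trans (Listₚ.length-++ (doubled n n 0 ℕₚ.≤-refl))
      (cong₂ _+_ (length-doubled n n 0 ℕₚ.≤-refl) (cong (2 +_) (Listₚ.length-map C.const (adv n))))

    size-mono : ∀ {t t' w w' l l'} b c → t ≤ t' → w ≤ w' → l ≤ l' → 1 + (3 + t * (w * b) + l * c) ≤ 1 + (3 + t' * (w' * b) + l' * c)
    size-mono b c t≤ w≤ l≤ = s≤s (ℕₚ.+-mono-≤ (ℕₚ.+-monoʳ-≤ 3 (ℕₚ.*-mono-≤ t≤ (ℕₚ.*-monoˡ-≤ b w≤))) (ℕₚ.*-monoˡ-≤ c l≤))

    size-bound : ∀ n → 1 + (3 + steps n * (W n * tableCost) + length (srcs n) * loadCost) ≤ ⟦ size ⟧ n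
    size-bound n = size-mono {steps n} {⟦ eT ⟧ n} {W n} {suc (⟦ eT ⟧ n + ⟦ eT ⟧ n)} {length (srcs n)} {⟦ eN ⟧ n} tableCost loadCost
      (steps≤ n) (s≤s (ℕₚ.+-mono-≤ (steps≤ n) (steps≤ n))) (ℕₚ.≤-trans (ℕₚ.≤-reflexive (length-srcs n)) (N≤ n))

    verifier-program : ∀ n → ∃ λ X → NonEmpty X × length X ≤ ⟦ size ⟧ n × Computes (n + h n) X (verifier n)
    verifier-program n = let X , ne , le , comp = C.program n (steps n) (srcs n) (steps n) (ℕₚ.+-monoʳ-≤ n (choices≤ n)) ℕₚ.≤-refl in
      X , ne , ℕₚ.≤-trans le (size-bound n) , comp

    g-program : ∀ m (d : Dec (Total m)) → ∃ λ X → NonEmpty X × length X ≤ ⟦ size ⟧ m × Computes m X (g-by d)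
    -- The output register is initially false, which is the value wanted here.
    g-program m (no _) = halt ∷ [] , s≤s z≤n , s≤s z≤n , λ v → 1 , refl
    g-program m (yes (n , lt , refl)) = let X , ne , le , comp = verifier-program n in
      X , ne , ℕₚ.≤-trans le (⟦⟧-mono size (ℕₚ.≤-pred lt)) , comp

    spec : ∀ n (w : Vec Bool n) → (f n w ≡ true) ⇔ (∃ λ (c : Vec Bool (h n)) → g (n + h n) (w ++ᵥ c) ≡ true)
    spec n w = mk⇔
      (λ e → let c , e' = from (verifier-correct n w) (to accepts e) in c , trans (g-verifier n (w ++ᵥ c)) e')
      (λ (c , e) → from accepts (to (verifier-correct n w) (c , trans (sym (g-verifier n (w ++ᵥ c))) e)))
      where
      y : List Bool
      y = pair (toList w) (adv n)
      f≡L' : f n w ≡ L' y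
      f≡L' = trans (sym (toLang-toList f w)) (trans (reduces (toList w)) (cong (λ k → L' (pair (toList w) (adv k))) (Vecₚ.length-toList w)))
      time : p (length y) ≡ steps n
      time = cong p (trans (length-pair (toList w) (adv n)) (cong (λ k → k + k + (2 + length (adv n))) (Vecₚ.length-toList w)))
      accepts : (f n w ≡ true) ⇔ Acc (steps n) (initConfig M y)
      accepts = mk⇔ (λ e → subst (λ t → Acc t (initConfig M y)) time (to (decides y) (trans (sym f≡L') e)))
        (λ a → trans f≡L' (from (decides y) (subst (λ t → Acc t (initConfig M y)) (sym time) a)))

  simulation : NP-IS f
  simulation = h , isPolynomial eh , ⟦⟧-mono eh , g , (⟦ size ⟧ , isPolynomial size , λ m → g-program m (total? m)) , spec

theorem12 : (f : BFamily) → NP-IS f ⇔ NP/poly (toLang f)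
theorem12 f = mk⇔ (NP-IS⇒NP/poly f)
  λ { (L' , (M , p , pp , decides) , adv , q , pq , adv≤ , reduces) → simulation f M {p} pp decides adv {q} pq adv≤ reduces }
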